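{- Every Sturmian word $\mathbf s$ satisfies $\mathrm{rep}(\mathbf s) \le \sqrt{10} - \frac{3}{2}$.
   Context: A Sturmian word is an infinite word $\mathbf x$ over a finite alphabet whose number $p(n,\mathbf x)$ of distinct factors of length $n$ equals $n+1$ for every $n\ge1$. With $x_i^j = x_i\cdots x_j$, $r(n,\mathbf x) = \min\{ m \ge 1 : x_i^{i+n-1} = x_{m-n+1}^{m} \text{ for some } i \text{ with } 1 \le i \le m-n\}$, and the exponent of repetition is $\mathrm{rep}(\mathbf x) = \liminf_{n\to+\infty} r(n,\mathbf x)/n$. -}

module Defs where

open import Data.Nat using (ℕ; zero; suc; _+_; _*_; _∸_; _^_; _≤_; _<_)
open import Data.Fin using (Fin; toℕ)
open import Data.Vec using (Vec; lookup)
open import Data.Product using (Σ; ∃; ∃-syntax; _×_)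
open import Function.Definitions using (Injective)
open import Relation.Binary.PropositionalEquality using (_≡_)

-- An infinite word over the finite alphabet Fin k.
-- Convention: the paper's letter x_i (i ≥ 1) is  x (i ∸ 1), i.e. x is 0-indexed.
Word : ℕ → Set
Word k = ℕ → Fin k

IsFactor : ∀ {k n} → Word k → Vec (Fin k) n → Set
IsFactor {k} {n} x w = ∃[ i ] (∀ (j : Fin n) → lookup w j ≡ x (i + toℕ j))

Complexity : ∀ {k} → Word k → ℕ → ℕ → Set
Complexity {k} x n c =
  Σ (Fin c → Vec (Fin k) n) λ f →
    Injective _≡_ _≡_ f
    × (∀ i → IsFactor x (f i))
    × (∀ (w : Vec (Fin k) n) → IsFactor x w → ∃[ i ] f i ≡ w)

Sturmian : ∀ {k} → Word k → Set
Sturmian x = ∀ n → 1 ≤ n → Complexity x n (suc n)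

-- RepEnd x n m : there is i with 1 ≤ i ≤ m - n and x_i^{i+n-1} = x_{m-n+1}^m
-- (paper indexing). With i' = i - 1 (0-indexed start), the condition
-- 1 ≤ i ≤ m - n becomes i' + n < m, and x_{m-n+1+j} = x (m ∸ n + j).
RepEnd : ∀ {k} → Word k → ℕ → ℕ → Set
RepEnd x n m =
  ∃[ i ] (i + n < m × (∀ j → j < n → x (i + j) ≡ x (m ∸ n + j)))

IsR : ∀ {k} → Word k → ℕ → ℕ → Set
IsR x n m = 1 ≤ m × RepEnd x n m × (∀ m' → 1 ≤ m' → RepEnd x n m' → m ≤ m')

-- The positive rational a/b (b > 0) exceeds √10 - 3/2, i.e.
-- (2a + 3b)/(2b) > √10, i.e. (2a+3b)^2 > 40 b^2 (2a+3b ≥ 0 automatically).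
AboveBound : ℕ → ℕ → Set
AboveBound a b = 40 * (b * b) < (2 * a + 3 * b) ^ 2

-- rep(x) ≤ √10 - 3/2, expressed as: for every rational a/b > √10 - 3/2,
-- there are infinitely many n with r(n, x)/n < a/b, i.e. b·r(n,x) < a·n.
RepAtMostBound : ∀ {k} → Word k → Set
RepAtMostBound x =
  ∀ (a b : ℕ) → 0 < b → AboveBound a b →
    ∀ (N : ℕ) → ∃[ n ] (N ≤ n × ∃[ m ] (IsR x n m × b * m < a * n))

{-# OPTIONS --safe #-}
module Submission where

-- It is enough to find long factors that occur twice near the beginning: x[i, i+n) = x[s, s+n)
-- with i < s gives r(n) ≤ s + n, so s / n must come below √10 − 5/2 + ε for infinitely many n.
--
-- A Sturmian word is, for each bispecial factor w, a sequence of two return words of w, the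
-- first one cut.  Let a and b be the lengths of the return word that comes first and of the
-- other one, and t the number of letters present of the first.  Then |w| = a + b − 2, and
-- passing to the next bispecial factor changes (a, b, t) by one of three linear maps S, D, O,
-- each of which exhibits repetitions near the beginning.  If none of them is good enough,
-- (a, b, t) satisfies linear inequalities, which after finitely many steps leave no choice
-- but the periodic sequence DDDODDDO….  Along it a / b tends to 1 + √10/2 and s / n, for the
-- repetition at the third D, to √10 − 5/2.

open import Defs
open import Data.Bool using (Bool; true; false; not; if_then_else_)
import Data.Bool.Properties as Bool
open import Data.Empty using (⊥; ⊥-elim)
open import Data.Fin as Fin using (Fin; toℕ; fromℕ<)
open import Data.Fin.Properties using (toℕ-fromℕ<; toℕ<n; pigeonhole)
open import Data.List using (List; []; _∷_; _++_; drop)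
open import Data.List.Properties using (≡-dec)
open import Data.List.Relation.Unary.All using (All; []; _∷_)
open import Data.List.Relation.Unary.All.Properties using (++⁺)
open import Data.Nat
open import Data.Nat.Induction using (<-rec)
open import Data.Nat.Properties
open import Data.Nat.Tactic.RingSolver using (solve-∀)
open import Data.Product using (∃; ∃-syntax; _×_; _,_; proj₁; proj₂)
open import Data.Sum using (_⊎_; inj₁; inj₂)
open import Data.Unit using (tt)
open import Data.Vec using (Vec; lookup; tabulate)
open import Data.Vec.Properties using (lookup∘tabulate; tabulate∘lookup; tabulate-cong)
open import Relation.Binary.PropositionalEquality
open import Relation.Nullary using (¬_; Dec; yes; no; does; contradiction)
open import Relation.Nullary.Decidable using (_×-dec_; map′; toWitness)

private
  variable
    A : Set

-- Agreement of factors given by their positions.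

record Agree {A : Set} (z : ℕ → A) (i j n : ℕ) : Set where
  constructor agree
  field at : ∀ k → k < n → z (i + k) ≡ z (j + k)
open Agree

agree-0 : ∀ {z : ℕ → A} {i j} → Agree z i j 0
agree-0 = agree λ _ ()

agree-1 : ∀ {z : ℕ → A} {i j} → z i ≡ z j → Agree z i j 1
agree-1 {z = z} {i} {j} p = agree λ where
  zero    _        → trans (cong z (+-identityʳ i)) (trans p (cong z (sym (+-identityʳ j))))
  (suc k) (s≤s ())

agree-sym : ∀ {z : ℕ → A} {i j n} → Agree z i j n → Agree z j i n
agree-sym p = agree λ k k<n → sym (at p k k<n)

agree-trans : ∀ {z : ℕ → A} {i j l n} → Agree z i j n → Agree z j l n → Agree z i l n
agree-trans p q = agree λ k k<n → trans (at p k k<n) (at q k k<n)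

agree-≤ : ∀ {z : ℕ → A} {i j m n} → m ≤ n → Agree z i j n → Agree z i j m
agree-≤ m≤n p = agree λ k k<m → at p k (<-≤-trans k<m m≤n)

agree-++ : ∀ {z : ℕ → A} {i j} m {n} →
           Agree z i j m → Agree z (i + m) (j + m) n → Agree z i j (m + n)
agree-++ {z = z} {i} {j} m {n} p q = agree go
  where
  open ≡-Reasoning
  go : ∀ k → k < m + n → z (i + k) ≡ z (j + k)
  go k k<m+n with k <? m
  ... | yes k<m = at p k k<m
  ... | no  k≮m = begin
    z (i + k)              ≡⟨ cong (λ l → z (i + l)) k≡ ⟩
    z (i + (m + (k ∸ m)))  ≡⟨ cong z (sym (+-assoc i m _)) ⟩
    z (i + m + (k ∸ m))    ≡⟨ at q (k ∸ m) (+-cancelˡ-< m _ _ (subst (_< m + n) k≡ k<m+n)) ⟩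
    z (j + m + (k ∸ m))    ≡⟨ cong z (+-assoc j m _) ⟩
    z (j + (m + (k ∸ m)))  ≡⟨ cong (λ l → z (j + l)) (sym k≡) ⟩
    z (j + k)              ∎
    where
    k≡ : k ≡ m + (k ∸ m)
    k≡ = sym (m+[n∸m]≡n (≮⇒≥ k≮m))

agree-uncons : ∀ {z : ℕ → A} {i j n} → Agree z i j (suc n) →
               z i ≡ z j × Agree z (suc i) (suc j) n
agree-uncons {z = z} {i} {j} p =
  subst₂ (λ u v → z u ≡ z v) (+-identityʳ i) (+-identityʳ j) (at p 0 (s≤s z≤n)) ,
  agree λ k k<n → subst₂ (λ u v → z u ≡ z v) (+-suc i k) (+-suc j k) (at p (suc k) (s≤s k<n))

mismatch? : ∀ (y : ℕ → Bool) i j n → Agree y i j n ⊎ ∃[ k ] y (i + k) ≢ y (j + k)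
mismatch? y i j zero = inj₁ agree-0
mismatch? y i j (suc n) with mismatch? y i j n | y (i + n) Bool.≟ y (j + n)
... | inj₂ r | _     = inj₂ r
... | inj₁ _ | no ≢  = inj₂ (n , ≢)
... | inj₁ p | yes ≡ = inj₁ (subst (Agree y i j) (+-comm n 1) (agree-++ n p (agree-1 ≡)))

rise : ∀ (y : ℕ → Bool) c i k → y i ≡ not c → y (i + k) ≡ c →
       ∃[ m ] (y m ≡ not c × y (suc m) ≡ c)
rise y c i zero p q =
  contradiction (trans (sym q) (trans (cong y (+-identityʳ i)) p)) (Bool.not-¬ refl)
rise y c i (suc k) p q with y (i + k) Bool.≟ c
... | yes r = rise y c i k p r
... | no  r = i + k , Bool.¬-not r , trans (cong y (sym (+-suc i k))) q

-- For no word w are both 0w and 1w right special; i c d is the position of a factor c w d.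
Uncrossed : (ℕ → Bool) → Set
Uncrossed z = ∀ n (i : Bool → Bool → ℕ) →
  (∀ c d → z (i c d) ≡ c) → (∀ c d → z (suc (i c d) + n) ≡ d) →
  (∀ c d → Agree z (suc (i c d)) (suc (i false false)) n) → ⊥

-- Coding by the return words of a bispecial factor.

module Words (z : ℕ → Bool) where

  -- E lists the positions preceding the occurrences of a bispecial factor w of length ℓ,
  -- and the letters z (E i) code z as a sequence of return words of lengths len c, of
  -- which the one numbered 0 is cut: only its last suc (E 0) letters are present.
  record State : Set where
    field
      E     : ℕ → ℕ
      len   : Bool → ℕ
      ℓ     : ℕ
      len≥1 : ∀ c → 1 ≤ len c
      len-ℓ : ∀ c → len c + len (not c) ≡ 2 + ℓ
      next  : ∀ i → E (suc i) ≡ E i + len (z (E (suc i)))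
      after : ∀ i → z (suc (E i) + ℓ) ≡ z (E (suc i))
      bisp  : ∀ i j → Agree z (suc (E i)) (suc (E j)) ℓ
      first : ∀ j → z (E 0) ≡ z (E j) →
              ∃[ d ] (E j ≡ d + E 0 × Agree z 0 d (suc (E 0)))
      cut   : suc (E 0) ≤ len (z (E 0))

    y : ℕ → Bool
    y i = z (E i)

    len≤ : ∀ c → len c ≤ suc ℓ
    len≤ c = +-cancelʳ-≤ 1 _ _ (≤-trans (+-monoʳ-≤ (len c) (len≥1 (not c)))
               (≤-reflexive (trans (len-ℓ c) (cong suc (+-comm 1 ℓ)))))

    -- By `len≤` a return word is a prefix of `w` followed by one letter, and by `after` that letter
    -- is the coding letter, which therefore determines the whole return word.
    block : ∀ {i j} → y (suc i) ≡ y (suc j) →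
            Agree z (suc (E i)) (suc (E j)) (len (y (suc i)))
    block {i} {j} p = agree-≤ (≤-trans (len≤ _) (≤-reflexive (+-comm 1 ℓ)))
      (agree-++ ℓ (bisp i j) (agree-1 (trans (after i) (trans p (sym (after j))))))

    next′ : ∀ i {c} → y (suc i) ≡ c → suc (E i) + len c ≡ suc (E (suc i))
    next′ i refl = cong suc (sym (next i))

    -- Prepends one return word to an agreement. With `n` equal to `ℓ` it gives `bisp` for the
    -- derived state, whose bispecial factor is the return word of `c` followed by `w`.
    extend : ∀ {i j c n} → y (suc i) ≡ c → y (suc j) ≡ c →
             Agree z (suc (E (suc i))) (suc (E (suc j))) n →
             Agree z (suc (E i)) (suc (E j)) (len c + n)
    extend {i} {j} {c} {n} p q r = agree-++ (len c)
      (subst (λ d → Agree z (suc (E i)) (suc (E j)) (len d)) p (block (trans p (sym q))))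
      (subst₂ (λ u v → Agree z u v n) (sym (next′ i p)) (sym (next′ j q)) r)

    -- Every return word has at least one letter. This crude length suffices for `breaks`, where the
    -- agreement can be asked to be as long as needed.
    agree-blocks : ∀ i j n → Agree y (suc i) (suc j) n → Agree z (suc (E i)) (suc (E j)) n
    agree-blocks i j zero    p = agree-0
    agree-blocks i j (suc n) p with p₀ , p₊ ← agree-uncons p =
      agree-≤ (+-monoˡ-≤ n (len≥1 (y (suc j))))
        (extend p₀ refl (agree-blocks (suc i) (suc j) n p₊))

    E-step : ∀ i → E i < E (suc i)
    E-step i = subst (E i <_) (sym (next i)) (m<m+n (E i) (len≥1 _))

    E-mono : ∀ i k → E i < E (i + suc k)
    E-mono i zero    = subst (λ j → E i < E j) (+-comm 1 i) (E-step i)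
    E-mono i (suc k) = <-trans (E-mono i k)
      (subst (λ j → E (i + suc k) < E j) (sym (+-suc i (suc k))) (E-step (i + suc k)))

  initial : State
  initial = record
    { E = λ i → i ; len = λ _ → 1 ; ℓ = 0
    ; len≥1 = λ _ → ≤-refl ; len-ℓ = λ _ → refl
    ; next = λ i → +-comm 1 i
    ; after = λ i → cong z (cong suc (+-identityʳ i))
    ; bisp = λ _ _ → agree-0
    ; first = λ j p → j , sym (+-identityʳ j) , agree-1 p
    ; cut = ≤-refl }

  module _ (σ : State) (c : Bool) where
    open State σ

    Isolates : Set
    Isolates = ∀ i → y i ≡ not c → y (suc i) ≡ c

    module Derived (iso : Isolates) where

      skip : Bool → ℕ
      skip d = if does (d Bool.≟ c) then 0 else 1

      -- e lists the indices i with y (suc i) ≡ c, so that y (e 0) y (e 1) … is the coding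
      -- by the return words c and c (not c), read off their last letters.
      e : ℕ → ℕ
      e zero    = skip (y 1)
      e (suc i) = skip (y (2 + e i)) + suc (e i)

      skip-c : ∀ {d} → d ≡ c → skip d ≡ 0
      skip-c {d} p with d Bool.≟ c
      ... | yes _ = refl
      ... | no ¬p = contradiction p ¬p

      skip-not : ∀ {d} → d ≡ not c → skip d ≡ 1
      skip-not {d} p with d Bool.≟ c
      ... | yes q = contradiction (trans (sym q) p) (Bool.not-¬ refl)
      ... | no  _ = refl

      skip-view : ∀ d → (d ≡ c × skip d ≡ 0) ⊎ (d ≡ not c × skip d ≡ 1)
      skip-view d with d Bool.≟ c
      ... | yes p = inj₁ (p , refl)
      ... | no  p = inj₂ (Bool.¬-not p , refl)

      e-step : ∀ i → (y (2 + e i) ≡ c × e (suc i) ≡ 1 + e i)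
                   ⊎ (y (2 + e i) ≡ not c × e (suc i) ≡ 2 + e i)
      e-step i with skip-view (y (2 + e i))
      ... | inj₁ (p , q) = inj₁ (p , cong (_+ suc (e i)) q)
      ... | inj₂ (p , q) = inj₂ (p , cong (_+ suc (e i)) q)

      e-next : ∀ i → y (suc (e i)) ≡ c
      e-next zero with skip-view (y 1)
      ... | inj₁ (p , q) = trans (cong (λ k → y (suc k)) q) p
      ... | inj₂ (p , q) = trans (cong (λ k → y (suc k)) q) (iso 1 p)
      e-next (suc i) with e-step i
      ... | inj₁ (p , q) = trans (cong (λ k → y (suc k)) q) p
      ... | inj₂ (p , q) = trans (cong (λ k → y (suc k)) q) (iso _ p)

      -- Needed for `after` in the derived state: `y (2 + e i)` follows the new bispecial factor at
      -- `e i`, and it has to be the last letter of the new return word that starts there.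
      y∘e-step : ∀ i → y (e (suc i)) ≡ y (2 + e i)
      y∘e-step i with e-step i
      ... | inj₁ (p , q) = trans (cong y q) (trans (e-next i) (sym p))
      ... | inj₂ (p , q) = cong y q

      len′ : Bool → ℕ
      len′ d = if does (d Bool.≟ c) then len c else len c + len (not c)

      len′-c : ∀ {d} → d ≡ c → len′ d ≡ len c
      len′-c {d} p with d Bool.≟ c
      ... | yes _ = refl
      ... | no ¬p = contradiction p ¬p

      len′-not : ∀ {d} → d ≡ not c → len′ d ≡ len c + len (not c)
      len′-not {d} p with d Bool.≟ c
      ... | yes q = contradiction (trans (sym q) p) (Bool.not-¬ refl)
      ... | no  _ = refl

      len′≥len : ∀ d → len d ≤ len′ d
      len′≥len d with d Bool.≟ c
      ... | yes p = ≤-reflexive (cong len p)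
      ... | no  p = ≤-trans (≤-reflexive (cong len (Bool.¬-not p))) (m≤n+m _ (len c))

      len-ℓ′ : ∀ d → len′ d + len′ (not d) ≡ 2 + (len c + ℓ)
      len-ℓ′ d with d Bool.≟ c
      ... | yes refl = begin
        len c + len′ (not c)           ≡⟨ cong (len c +_) (len′-not refl) ⟩
        len c + (len c + len (not c))  ≡⟨ cong (len c +_) (len-ℓ c) ⟩
        len c + (2 + ℓ)                ≡⟨ +-assoc (len c) 2 ℓ ⟨
        len c + 2 + ℓ                  ≡⟨ cong (_+ ℓ) (+-comm (len c) 2) ⟩
        2 + (len c + ℓ)                ∎
        where open ≡-Reasoning
      ... | no ¬p = begin
        len c + len (not c) + len′ (not d)  ≡⟨ cong₂ _+_ (len-ℓ c)
                                                 (len′-c (trans (cong not (Bool.¬-not ¬p)) (Bool.not-involutive c))) ⟩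
        2 + (ℓ + len c)                     ≡⟨ cong (2 +_) (+-comm ℓ (len c)) ⟩
        2 + (len c + ℓ)                     ∎
        where open ≡-Reasoning

      next-e : ∀ i → E (e (suc i)) ≡ E (e i) + len′ (y (e (suc i)))
      next-e i with e-step i
      ... | inj₁ (p , q) rewrite q =
        trans (next (e i)) (cong (E (e i) +_) (trans (cong len (e-next i)) (sym (len′-c (e-next i)))))
      ... | inj₂ (p , q) rewrite q = begin
        E (2 + e i)                      ≡⟨ next (suc (e i)) ⟩
        E (1 + e i) + len (y (2 + e i))  ≡⟨ cong₂ _+_ (next (e i)) (cong len p) ⟩
        E (e i) + len (y (1 + e i)) + len (not c)
          ≡⟨ cong (λ k → E (e i) + len k + len (not c)) (e-next i) ⟩
        E (e i) + len c + len (not c)    ≡⟨ +-assoc (E (e i)) _ _ ⟩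
        E (e i) + (len c + len (not c))  ≡⟨ cong (E (e i) +_) (len′-not p) ⟨
        E (e i) + len′ (y (2 + e i))     ∎
        where open ≡-Reasoning

      y0≡c : y 1 ≡ not c → y 0 ≡ c
      y0≡c p with y 0 Bool.≟ c
      ... | yes q = q
      ... | no  q = contradiction (trans (sym (iso 0 (Bool.¬-not q))) p) (Bool.not-¬ refl)

      -- Here the first new return word is the cut `c` followed by a whole `not c`. Every later
      -- `not c` is preceded by `c`, so `first` applies one index earlier and `block` appends the
      -- rest.
      first-c : y 1 ≡ not c → ∀ k → y k ≡ not c →
                ∃[ d ] (E k ≡ d + E 1 × Agree z 0 d (suc (E 1)))
      first-c p zero    q = contradiction (trans (sym (y0≡c p)) q) (Bool.not-¬ refl)
      first-c p (suc k) q with y k Bool.≟ c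
      ... | no  r = contradiction (trans (sym (iso k (Bool.¬-not r))) q) (Bool.not-¬ refl)
      ... | yes r with d , s , u ← first k (trans (y0≡c p) (sym r)) =
        d , E-eq , subst (Agree z 0 d) (next′ 0 p)
          (agree-++ (suc (E 0)) u (subst₂ (λ m n → Agree z (suc (E 0)) m n)
            (trans (cong suc s) (sym (+-suc d (E 0)))) (cong len p) (block (trans p (sym q)))))
        where
        open ≡-Reasoning
        E-eq : E (suc k) ≡ d + E 1
        E-eq = begin
          E (suc k)                ≡⟨ next k ⟩
          E k + len (y (suc k))    ≡⟨ cong₂ (λ m n → m + len n) s (trans q (sym p)) ⟩
          d + E 0 + len (y 1)      ≡⟨ +-assoc d (E 0) _ ⟩
          d + (E 0 + len (y 1))    ≡⟨ cong (d +_) (next 0) ⟨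
          d + E 1                  ∎

      first-e : ∀ j → y (e 0) ≡ y (e j) → ∃[ d ] (E (e j) ≡ d + E (e 0) × Agree z 0 d (suc (E (e 0))))
      first-e j q with skip-view (y 1)
      ... | inj₁ (_ , e0≡) rewrite e0≡ = first (e j) q
      ... | inj₂ (p , e0≡) rewrite e0≡ = first-c p (e j) (trans (sym q) p)

      cut-e : suc (E (e 0)) ≤ len′ (y (e 0))
      cut-e with skip-view (y 1)
      ... | inj₁ (_ , e0≡) rewrite e0≡ = ≤-trans cut (len′≥len (y 0))
      ... | inj₂ (p , e0≡) rewrite e0≡ = begin
        suc (E 1)                ≡⟨ next′ 0 p ⟨
        suc (E 0) + len (not c)  ≤⟨ +-monoˡ-≤ (len (not c)) cut ⟩
        len (y 0) + len (not c)  ≡⟨ cong (λ d → len d + len (not c)) (y0≡c p) ⟩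
        len c + len (not c)      ≡⟨ len′-not p ⟨
        len′ (y 1)               ∎
        where open ≤-Reasoning

      derived : State
      derived = record
        { E = λ i → E (e i) ; len = len′ ; ℓ = len c + ℓ
        ; len≥1 = λ d → ≤-trans (len≥1 d) (len′≥len d)
        ; len-ℓ = len-ℓ′
        ; next = next-e
        ; after = λ i → trans (cong z (trans (sym (+-assoc (suc (E (e i))) (len c) ℓ))
                                             (cong (_+ ℓ) (next′ (e i) (e-next i)))))
                              (trans (after (suc (e i))) (sym (y∘e-step i)))
        ; bisp = λ i j → extend (e-next i) (e-next j) (bisp (suc (e i)) (suc (e j)))
        ; first = first-e
        ; cut = cut-e }

-- Moves on triples of lengths.

Triple : Set
Triple = ℕ × ℕ × ℕ

-- How the first two coding letters c₀ c₁ meet the letter that occurs doubled: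
-- S: c₀ = c₁ is doubled;  D: c₀ ≠ c₁ and c₀ is doubled;  O: c₀ ≠ c₁ and c₁ is doubled.
data Move : Set where
  S D O : Move

act : Move → Triple → Triple
act S (a , b , t) = a , a + b , t
act D (a , b , t) = a + b , a , t + b
act O (a , b , t) = a + b , b , t

size : Triple → ℕ
size (a , b , t) = a + b

record Positive (v : Triple) : Set where
  constructor positive
  field
    a≥1 : 1 ≤ proj₁ v
    b≥1 : 1 ≤ proj₁ (proj₂ v)

-- The first argument holds the coefficients of a linear form.
eval : Triple → Triple → ℕ
eval (x , y , w) (a , b , t) = x * a + y * b + w * t

infixl 6 _⊕_
infixl 7 _⊛_
_⊕_ : Triple → Triple → Triple
(x , y , w) ⊕ (x′ , y′ , w′) = x + x′ , y + y′ , w + w′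

_⊛_ : ℕ → Triple → Triple
k ⊛ (x , y , w) = k * x , k * y , k * w

eval-⊕ : ∀ f g v → eval (f ⊕ g) v ≡ eval f v + eval g v
eval-⊕ (x , y , w) (x′ , y′ , w′) (a , b , t) = identity x y w x′ y′ w′ a b t
  where
  identity : ∀ x y w x′ y′ w′ a b t →
    (x + x′) * a + (y + y′) * b + (w + w′) * t ≡ (x * a + y * b + w * t) + (x′ * a + y′ * b + w′ * t)
  identity = solve-∀

eval-⊛ : ∀ k f v → eval (k ⊛ f) v ≡ k * eval f v
eval-⊛ k (x , y , w) (a , b , t) = identity k x y w a b t
  where
  identity : ∀ k x y w a b t → k * x * a + k * y * b + k * w * t ≡ k * (x * a + y * b + w * t)
  identity = solve-∀

-- Linear inequalities, their combinations, and certified search trees.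

Inequality : Set
Inequality = Triple × Triple

Holds : Triple → Inequality → Set
Holds v (l , r) = eval l v ≤ eval r v

combine : List ℕ → List Inequality → Inequality
combine (k ∷ ks) ((l , r) ∷ rs) = k ⊛ l ⊕ proj₁ (combine ks rs) , k ⊛ r ⊕ proj₂ (combine ks rs)
-- A list of multipliers that ends early stands for zeros on the older inequalities.
combine _        _              = (0 , 0 , 0) , (0 , 0 , 0)

combine-holds : ∀ v ks rs → All (Holds v) rs → Holds v (combine ks rs)
combine-holds v []       rs             _        = ≤-refl
combine-holds v (k ∷ ks) []             _        = ≤-refl
combine-holds v (k ∷ ks) ((l , r) ∷ rs) (h ∷ hs) = begin
  eval (k ⊛ l ⊕ L) v       ≡⟨ eval-⊕ (k ⊛ l) L v ⟩
  eval (k ⊛ l) v + eval L v ≡⟨ cong (_+ eval L v) (eval-⊛ k l v) ⟩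
  k * eval l v + eval L v  ≤⟨ +-mono-≤ (*-monoʳ-≤ k h) (combine-holds v ks rs hs) ⟩
  k * eval r v + eval R v  ≡⟨ cong (_+ eval R v) (eval-⊛ k r v) ⟨
  eval (k ⊛ r) v + eval R v ≡⟨ eval-⊕ (k ⊛ r) R v ⟨
  eval (k ⊛ r ⊕ R) v       ∎
  where
  open ≤-Reasoning
  L = proj₁ (combine ks rs)
  R = proj₂ (combine ks rs)

-- The left side dominates coefficientwise, strictly at `a`, which is at least 1; so it is the
-- larger side at every positive triple.
Absurd : Inequality → Set
Absurd ((x , y , w) , (x′ , y′ , w′)) = x′ < x × y′ ≤ y × w′ ≤ w

absurd? : ∀ r → Dec (Absurd r)
absurd? ((x , y , w) , (x′ , y′ , w′)) = x′ <? x ×-dec y′ ≤? y ×-dec w′ ≤? w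

absurd : ∀ r v → Positive v → Absurd r → ¬ Holds v r
absurd ((x , y , w) , (x′ , y′ , w′)) (suc a , b , t) (positive a≥1 _) (p , q , r) h =
  <⇒≱ (+-mono-<-≤ (+-mono-<-≤ (*-monoˡ-< (suc a) p) (*-monoˡ-≤ b q)) (*-monoˡ-≤ t r)) h

-- The inequality s / (n + 2) ≥ 15/23, weaker than s / n ≥ √10 − 5/2 for large n, at the
-- repetitions that the given move exhibits.
Coarse : Move → Triple → Set
Coarse S (a , b , t) = 15 * (t + (a + b)) ≤ 23 * a
Coarse D (a , b , t) = 15 * (a + b) ≤ 23 * (t + b) × 15 * (t + (a + b)) ≤ 23 * (a + b)
Coarse O (a , b , t) = 15 * (a + b) ≤ 23 * (t + b)

-- The current triple as three linear forms in the triple at the start of the history. Moves then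
-- act on numerals, and certificates can be checked by evaluation.
Forms : Set
Forms = Triple × Triple × Triple

evals : Forms → Triple → Triple
evals (f , g , h) v = eval f v , eval g v , eval h v

actF : Move → Forms → Forms
actF S (f , g , h) = f , f ⊕ g , h
actF D (f , g , h) = f ⊕ g , f , h ⊕ g
actF O (f , g , h) = f ⊕ g , g , h

evals-actF : ∀ m F v → evals (actF m F) v ≡ act m (evals F v)
evals-actF S (f , g , h) v = cong (λ x → eval f v , x , eval h v) (eval-⊕ f g v)
evals-actF D (f , g , h) v = cong₂ (λ x y → x , eval f v , y) (eval-⊕ f g v) (eval-⊕ h g v)
evals-actF O (f , g , h) v = cong (λ x → x , eval g v , eval h v) (eval-⊕ f g v)

-- `D` contributes two rows and the other moves one; this fixes the places of the multipliers in the
-- certificates.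
rows : Move → Forms → List Inequality
rows S (f , g , h) = (15 ⊛ (h ⊕ (f ⊕ g)) , 23 ⊛ f) ∷ []
rows D (f , g , h) = (15 ⊛ (f ⊕ g) , 23 ⊛ (h ⊕ g)) ∷ (15 ⊛ (h ⊕ (f ⊕ g)) , 23 ⊛ (f ⊕ g)) ∷ []
rows O (f , g , h) = (15 ⊛ (f ⊕ g) , 23 ⊛ (h ⊕ g)) ∷ []

rows-hold : ∀ m F v → Coarse m (evals F v) → All (Holds v) (rows m F)
rows-hold m (f , g , h) v = go m
  where
  scaled : ∀ k l f g {x y} → eval f v ≡ x → eval g v ≡ y → k * x ≤ l * y → Holds v (k ⊛ f , l ⊛ g)
  scaled k l f g refl refl = subst₂ _≤_ (sym (eval-⊛ k f v)) (sym (eval-⊛ l g v))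
  f+g : eval (f ⊕ g) v ≡ eval f v + eval g v
  f+g = eval-⊕ f g v
  h+f+g : eval (h ⊕ (f ⊕ g)) v ≡ eval h v + (eval f v + eval g v)
  h+f+g = trans (eval-⊕ h (f ⊕ g) v) (cong (eval h v +_) f+g)
  go : ∀ m → Coarse m (evals (f , g , h) v) → All (Holds v) (rows m (f , g , h))
  go S p       = scaled 15 23 (h ⊕ (f ⊕ g)) f h+f+g refl p ∷ []
  go D (p , q) = scaled 15 23 (f ⊕ g) (h ⊕ g) f+g (eval-⊕ h g v) p
               ∷ scaled 15 23 (h ⊕ (f ⊕ g)) (f ⊕ g) h+f+g f+g q ∷ []
  go O p       = scaled 15 23 (f ⊕ g) (h ⊕ g) f+g (eval-⊕ h g v) p ∷ []

-- Histories list the latest move first.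
formsAfter : List Move → Forms
formsAfter []      = (1 , 0 , 0) , (0 , 1 , 0) , (0 , 0 , 1)
formsAfter (m ∷ h) = actF m (formsAfter h)

rowsAfter : List Inequality → List Move → List Inequality
rowsAfter rs []      = rs
rowsAfter rs (m ∷ h) = rows m (formsAfter h) ++ rowsAfter rs h

-- A dead branch carries the multipliers of a Farkas certificate: the combination of the
-- inequalities met on the way, latest first, that no positive triple satisfies.
data Tree : Set where
  dead : List ℕ → Tree
  leaf : Tree
  node : Tree → Tree → Tree → Tree

module _ {P : List Move → Set} (P? : ∀ h → Dec (P h)) (rs : List Inequality) where

  Certified : Tree → List Move → Set
  Certified (dead ks)    h = Absurd (combine ks (rowsAfter rs h))
  Certified leaf         h = P h
  Certified (node s d o) h = Certified s (S ∷ h) × Certified d (D ∷ h) × Certified o (O ∷ h)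

  certified? : ∀ T h → Dec (Certified T h)
  certified? (dead ks)    h = absurd? (combine ks (rowsAfter rs h))
  certified? leaf         h = P? h
  certified? (node s d o) h = certified? s (S ∷ h) ×-dec certified? d (D ∷ h) ×-dec certified? o (O ∷ h)

_≟ᴹ_ : (m m′ : Move) → Dec (m ≡ m′)
S ≟ᴹ S = yes refl
S ≟ᴹ D = no λ ()
S ≟ᴹ O = no λ ()
D ≟ᴹ S = no λ ()
D ≟ᴹ D = yes refl
D ≟ᴹ O = no λ ()
O ≟ᴹ S = no λ ()
O ≟ᴹ D = no λ ()
O ≟ᴹ O = yes refl

-- The period and the two search trees.

period : List Move
period = O ∷ D ∷ D ∷ D ∷ []

EndsWithPeriod : List Move → Set
EndsWithPeriod h = h ≡ period ++ drop 4 h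

endsWithPeriod? : ∀ h → Dec (EndsWithPeriod h)
endsWithPeriod? h = ≡-dec _≟ᴹ_ h (period ++ drop 4 h)

TwoPeriods : List Move → Set
TwoPeriods h = h ≡ period ++ period

twoPeriods? : ∀ h → Dec (TwoPeriods h)
twoPeriods? h = ≡-dec _≟ᴹ_ h (period ++ period)

-- In coordinates: `b ≤ a` and `a ≤ 2 * b`, which `Balanced` supplies, and `t ≤ a`, which is `cut`.
startRows loopRows : List Inequality
startRows = ((0 , 1 , 0) , (1 , 0 , 0)) ∷ ((1 , 0 , 0) , (0 , 2 , 0)) ∷ loopRows
loopRows  = ((0 , 0 , 1) , (1 , 0 , 0)) ∷ []

-- Every branch that is not refuted ends as soon as the moves D, D, D, O have just been made.
startTree : Tree
startTree =
  node (node (dead (1 ∷ []))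
      (dead (1 ∷ 0 ∷ 2 ∷ 0 ∷ 10 ∷ []))
      (dead (1 ∷ 2 ∷ 0 ∷ 10 ∷ [])))
    (node (dead (1 ∷ []))
      (node (dead (1 ∷ []))
        (node (dead (1 ∷ []))
          (dead (0 ∷ 17 ∷ 0 ∷ 0 ∷ 0 ∷ 0 ∷ 11 ∷ 0 ∷ 0 ∷ 6 ∷ []))
          leaf)
        (node (dead (1 ∷ []))
          (node (dead (1 ∷ []))
            (node (dead (1 ∷ []))
              (node (dead (1 ∷ []))
                (dead (0 ∷ 17 ∷ 0 ∷ 0 ∷ 0 ∷ 0 ∷ 11 ∷ []))
                leaf)
              (node (dead (1 ∷ []))
                (dead (5 ∷ 0 ∷ 0 ∷ 0 ∷ 0 ∷ 0 ∷ 0 ∷ 0 ∷ 0 ∷ 3 ∷ 0 ∷ 5 ∷ []))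
                (dead (5 ∷ 0 ∷ 0 ∷ 0 ∷ 0 ∷ 0 ∷ 0 ∷ 0 ∷ 3 ∷ 0 ∷ 5 ∷ []))))
            (node (dead (1 ∷ []))
              (dead (2 ∷ 0 ∷ 0 ∷ 0 ∷ 3 ∷ 0 ∷ 0 ∷ 1 ∷ []))
              (dead (2 ∷ 0 ∷ 0 ∷ 3 ∷ 0 ∷ 0 ∷ 1 ∷ []))))
          (node (dead (2 ∷ 1 ∷ []))
            (dead (3 ∷ 0 ∷ 0 ∷ 0 ∷ 0 ∷ 5 ∷ []))
            (dead (3 ∷ 0 ∷ 0 ∷ 0 ∷ 5 ∷ [])))))
      (node (dead (2 ∷ 1 ∷ []))
        (node (dead (1 ∷ []))
          (node (dead (1 ∷ []))
            (node (dead (1 ∷ []))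
              (dead (0 ∷ 20 ∷ 0 ∷ 0 ∷ 0 ∷ 0 ∷ 13 ∷ 0 ∷ 0 ∷ 0 ∷ 0 ∷ 5 ∷ []))
              leaf)
            (node (dead (1 ∷ []))
              (node (dead (1 ∷ []))
                (node (dead (1 ∷ []))
                  (node (dead (1 ∷ []))
                    (dead (0 ∷ 11 ∷ 0 ∷ 0 ∷ 0 ∷ 0 ∷ 7 ∷ []))
                    leaf)
                  (node (dead (1 ∷ []))
                    (dead (5 ∷ 0 ∷ 0 ∷ 0 ∷ 0 ∷ 0 ∷ 0 ∷ 0 ∷ 0 ∷ 3 ∷ 0 ∷ 5 ∷ []))
                    (dead (5 ∷ 0 ∷ 0 ∷ 0 ∷ 0 ∷ 0 ∷ 0 ∷ 0 ∷ 3 ∷ 0 ∷ 5 ∷ []))))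
                (node (dead (1 ∷ []))
                  (dead (3 ∷ 0 ∷ 0 ∷ 0 ∷ 5 ∷ []))
                  (dead (3 ∷ 0 ∷ 0 ∷ 5 ∷ []))))
              (node (dead (1 ∷ []))
                (dead (1 ∷ 0 ∷ 0 ∷ 0 ∷ 0 ∷ 2 ∷ []))
                (dead (1 ∷ 0 ∷ 0 ∷ 0 ∷ 2 ∷ [])))))
          (node (dead (1 ∷ []))
            (dead (4 ∷ 0 ∷ 0 ∷ 0 ∷ 5 ∷ 0 ∷ 0 ∷ 2 ∷ []))
            (dead (4 ∷ 0 ∷ 0 ∷ 5 ∷ 0 ∷ 0 ∷ 2 ∷ []))))
        (node (dead (2 ∷ 1 ∷ []))
          (dead (3 ∷ 0 ∷ 0 ∷ 0 ∷ 0 ∷ 5 ∷ 64 ∷ []))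
          (dead (3 ∷ 0 ∷ 0 ∷ 0 ∷ 5 ∷ 64 ∷ [])))))
    (node (dead (5 ∷ 3 ∷ []))
      (node (dead (1 ∷ []))
        (node (dead (1 ∷ []))
          (node (dead (1 ∷ []))
            (dead (0 ∷ 23 ∷ 0 ∷ 0 ∷ 0 ∷ 0 ∷ 15 ∷ 0 ∷ 0 ∷ 0 ∷ 6 ∷ []))
            leaf)
          (node (dead (1 ∷ []))
            (node (dead (1 ∷ []))
              (node (dead (1 ∷ []))
                (node (dead (1 ∷ []))
                  (dead (0 ∷ 17 ∷ 0 ∷ 0 ∷ 0 ∷ 0 ∷ 11 ∷ []))
                  leaf)
                (node (dead (1 ∷ []))
                  (dead (5 ∷ 0 ∷ 0 ∷ 0 ∷ 0 ∷ 0 ∷ 0 ∷ 0 ∷ 0 ∷ 3 ∷ 0 ∷ 5 ∷ []))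
                  (dead (5 ∷ 0 ∷ 0 ∷ 0 ∷ 0 ∷ 0 ∷ 0 ∷ 0 ∷ 3 ∷ 0 ∷ 5 ∷ []))))
              (node (dead (1 ∷ []))
                (dead (3 ∷ 0 ∷ 0 ∷ 0 ∷ 5 ∷ []))
                (dead (3 ∷ 0 ∷ 0 ∷ 5 ∷ []))))
            (node (dead (2 ∷ 1 ∷ []))
              (dead (3 ∷ 0 ∷ 0 ∷ 0 ∷ 0 ∷ 5 ∷ []))
              (dead (3 ∷ 0 ∷ 0 ∷ 0 ∷ 5 ∷ [])))))
        (node (dead (2 ∷ 1 ∷ []))
          (dead (3 ∷ 0 ∷ 0 ∷ 0 ∷ 2 ∷ 0 ∷ 0 ∷ 0 ∷ 39 ∷ []))
          (dead (3 ∷ 0 ∷ 0 ∷ 2 ∷ 0 ∷ 0 ∷ 0 ∷ 39 ∷ []))))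
      (node (dead (5 ∷ 3 ∷ []))
        (dead (1 ∷ 0 ∷ 0 ∷ 0 ∷ 0 ∷ 10 ∷ 23 ∷ []))
        (dead (1 ∷ 0 ∷ 0 ∷ 0 ∷ 10 ∷ 23 ∷ []))))

-- Read from the history `period`: certificates may also use the rows of the period already made,
-- which take the place of a bound on `a / b`. The only leaf is a second period.
loopTree : Tree
loopTree =
  node (dead (1 ∷ []))
    (node (dead (1 ∷ []))
      (node (dead (1 ∷ []))
        (node (dead (1 ∷ []))
          (dead (0 ∷ 8 ∷ 0 ∷ 0 ∷ 0 ∷ 0 ∷ 5 ∷ []))
          leaf)
        (node (dead (1 ∷ []))
          (dead (5 ∷ 0 ∷ 0 ∷ 0 ∷ 0 ∷ 0 ∷ 0 ∷ 0 ∷ 0 ∷ 3 ∷ 0 ∷ 5 ∷ []))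
          (dead (5 ∷ 0 ∷ 0 ∷ 0 ∷ 0 ∷ 0 ∷ 0 ∷ 0 ∷ 3 ∷ 0 ∷ 5 ∷ []))))
      (node (dead (1 ∷ []))
        (dead (3 ∷ 0 ∷ 0 ∷ 0 ∷ 5 ∷ []))
        (dead (3 ∷ 0 ∷ 0 ∷ 5 ∷ []))))
    (node (dead (1 ∷ []))
      (dead (1 ∷ 0 ∷ 0 ∷ 0 ∷ 0 ∷ 2 ∷ []))
      (dead (1 ∷ 0 ∷ 0 ∷ 0 ∷ 2 ∷ [])))

start-certified : Certified endsWithPeriod? startRows startTree []
start-certified = toWitness {a? = certified? endsWithPeriod? startRows startTree []} tt

loop-certified : Certified twoPeriods? loopRows loopTree period
loop-certified = toWitness {a? = certified? twoPeriods? loopRows loopTree period} tt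

-- Arithmetic of √10: the bound, and triples close to the limit direction.

above⇒1·66 : ∀ p q → AboveBound p q → 83 * q ≤ 50 * p
above⇒1·66 p q above = ≮⇒≥ λ 50p<83q → <-irrefl refl (begin-strict
  625 * (40 * (q * q))                  <⟨ *-monoʳ-< 625 above ⟩
  625 * W ^ 2                           ≡⟨ square W ⟩
  (25 * W) * (25 * W)                   ≤⟨ *-mono-≤ (small 50p<83q) (small 50p<83q) ⟩
  -- If `p / q` were below 1.66, then `W / q` would be at most 6.32 = 158/25, and 158² = 24964 is 36
  -- less than 625 · 40.
  (158 * q) * (158 * q)                 ≤⟨ m≤m+n _ (36 * (q * q)) ⟩
  (158 * q) * (158 * q) + 36 * (q * q)  ≡⟨ numerals q ⟩
  625 * (40 * (q * q))                  ∎)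
  where
  open ≤-Reasoning
  W = 2 * p + 3 * q
  square : ∀ w → 625 * (w * (w * 1)) ≡ (25 * w) * (25 * w)
  square = solve-∀
  numerals : ∀ q → (158 * q) * (158 * q) + 36 * (q * q) ≡ 625 * (40 * (q * q))
  numerals = solve-∀
  expand : ∀ p q → 25 * (2 * p + 3 * q) ≡ 50 * p + 75 * q
  expand = solve-∀
  collect : ∀ q → 83 * q + 75 * q ≡ 158 * q
  collect = solve-∀
  small : 50 * p < 83 * q → 25 * W ≤ 158 * q
  small h = subst₂ _≤_ (sym (expand p q)) (collect q) (+-monoˡ-≤ (75 * q) (<⇒≤ h))

-- The number √10 - 5/2 is the positive root of 4x² + 20x - 15. Strictness of `AboveBound` between
-- integers is worth 1, and this leaves the surplus `n * n`, the term that `bounded` exploits.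
tight⇒quadratic : ∀ p q s n → AboveBound p q → p * n ≤ q * (s + n) →
  n * n + q * q * (15 * (n * n)) ≤ q * q * (4 * (s * s) + 20 * (s * n))
tight⇒quadratic p q s n above h = +-cancelʳ-≤ (25 * (q * q) * (n * n)) _ _ (begin
  n * n + q * q * (15 * (n * n)) + 25 * (q * q) * (n * n)  ≡⟨ lhs q n ⟩
  suc (40 * (q * q)) * (n * n)                             ≤⟨ *-monoˡ-≤ (n * n) above ⟩
  W ^ 2 * (n * n)                                          ≡⟨ square W n ⟩
  (W * n) * (W * n)                                        ≤⟨ *-mono-≤ Wn Wn ⟩
  (q * (2 * s + 5 * n)) * (q * (2 * s + 5 * n))            ≡⟨ rhs q s n ⟩
  q * q * (4 * (s * s) + 20 * (s * n)) + 25 * (q * q) * (n * n) ∎)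
  where
  open ≤-Reasoning
  W = 2 * p + 3 * q
  lhs : ∀ q n → n * n + q * q * (15 * (n * n)) + 25 * (q * q) * (n * n) ≡ (1 + 40 * (q * q)) * (n * n)
  lhs = solve-∀
  square : ∀ w n → w * (w * 1) * (n * n) ≡ (w * n) * (w * n)
  square = solve-∀
  rhs : ∀ q s n → (q * (2 * s + 5 * n)) * (q * (2 * s + 5 * n))
                ≡ q * q * (4 * (s * s) + 20 * (s * n)) + 25 * (q * q) * (n * n)
  rhs = solve-∀
  expand : ∀ p q n → (2 * p + 3 * q) * n ≡ 2 * (p * n) + 3 * q * n
  expand = solve-∀
  collect : ∀ q s n → 2 * (q * (s + n)) + 3 * q * n ≡ q * (2 * s + 5 * n)
  collect = solve-∀
  Wn : W * n ≤ q * (2 * s + 5 * n)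
  Wn = subst₂ _≤_ (sym (expand p q n)) (collect q s n) (+-monoˡ-≤ (3 * q * n) (*-monoʳ-≤ 2 h))

-- 15 h² − 60 s h − 36 s² = 48 (2a² − 4ab − 3b²) at s = 3a + 2b, h = 14a + 8b, and m is
-- not much smaller than h.
near-root : ∀ a b m g Q → let s = 3 * a + 2 * b ; h = 14 * a + 8 * b in
  h ≤ m + g → 4 * (a * b) + 3 * (b * b) ≤ 2 * (a * a) + Q →
  36 * (s * s) + 60 * (s * m) ≤ 15 * (m * m) + (48 * Q + 30 * (g * h))
near-root a b m g Q h≤m+g hQ = by-cases (≤-total h m)
  where
  open ≤-Reasoning
  s = 3 * a + 2 * b
  h = 14 * a + 8 * b
  identity : ∀ a b → 36 * ((3 * a + 2 * b) * (3 * a + 2 * b))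
      + 60 * ((3 * a + 2 * b) * (14 * a + 8 * b)) + 96 * (a * a)
    ≡ 15 * ((14 * a + 8 * b) * (14 * a + 8 * b)) + 48 * (4 * (a * b) + 3 * (b * b))
  identity = solve-∀
  regroup : ∀ x a Q → x + 48 * (2 * (a * a) + Q) ≡ x + 48 * Q + 96 * (a * a)
  regroup = solve-∀
  at-h : 36 * (s * s) + 60 * (s * h) ≤ 15 * (h * h) + 48 * Q
  at-h = +-cancelʳ-≤ (96 * (a * a)) _ _ (begin
    36 * (s * s) + 60 * (s * h) + 96 * (a * a)        ≡⟨ identity a b ⟩
    15 * (h * h) + 48 * (4 * (a * b) + 3 * (b * b))   ≤⟨ +-monoʳ-≤ (15 * (h * h)) (*-monoʳ-≤ 48 hQ) ⟩
    15 * (h * h) + 48 * (2 * (a * a) + Q)             ≡⟨ regroup (15 * (h * h)) a Q ⟩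
    15 * (h * h) + 48 * Q + 96 * (a * a)              ∎)
  2s+ : ∀ a b → 2 * (3 * a + 2 * b) + (8 * a + 4 * b) ≡ 14 * a + 8 * b
  2s+ = solve-∀
  -- Replacing `h` by `h + d` adds `60 * (s * d)` on the left and at least `30 * (h * d)` on the
  -- right, so this inequality is what the case `h ≤ m` needs.
  2s≤h : 2 * s ≤ h
  2s≤h = ≤-trans (m≤m+n (2 * s) (8 * a + 4 * b)) (≤-reflexive (2s+ a b))
  split : ∀ s h d → 36 * (s * s) + 60 * (s * (h + d)) ≡ 36 * (s * s) + 60 * (s * h) + 30 * (2 * s * d)
  split = solve-∀
  merge : ∀ h d Q → 15 * (h * h) + 48 * Q + 30 * (h * d) + 15 * (d * d) ≡ 15 * ((h + d) * (h + d)) + 48 * Q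
  merge = solve-∀
  merge′ : ∀ m d Q → 15 * ((m + d) * (m + d)) + 48 * Q + 15 * (d * d)
                   ≡ 15 * (m * m) + (48 * Q + 30 * (d * (m + d)))
  merge′ = solve-∀
  by-cases : h ≤ m ⊎ m ≤ h → 36 * (s * s) + 60 * (s * m) ≤ 15 * (m * m) + (48 * Q + 30 * (g * h))
  by-cases (inj₁ h≤m) = begin
    36 * (s * s) + 60 * (s * m)                            ≡⟨ cong (λ x → 36 * (s * s) + 60 * (s * x)) m≡ ⟩
    36 * (s * s) + 60 * (s * (h + d))                      ≡⟨ split s h d ⟩
    36 * (s * s) + 60 * (s * h) + 30 * (2 * s * d)         ≤⟨ +-mono-≤ at-h (*-monoʳ-≤ 30 (*-monoˡ-≤ d 2s≤h)) ⟩
    15 * (h * h) + 48 * Q + 30 * (h * d)                   ≤⟨ m≤m+n _ (15 * (d * d)) ⟩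
    15 * (h * h) + 48 * Q + 30 * (h * d) + 15 * (d * d)    ≡⟨ merge h d Q ⟩
    15 * ((h + d) * (h + d)) + 48 * Q                      ≡⟨ cong (λ x → 15 * (x * x) + 48 * Q) m≡ ⟨
    15 * (m * m) + 48 * Q                                  ≤⟨ +-monoʳ-≤ (15 * (m * m)) (m≤m+n (48 * Q) _) ⟩
    15 * (m * m) + (48 * Q + 30 * (g * h))                 ∎
    where
    d = m ∸ h
    m≡ : m ≡ h + d
    m≡ = sym (m+[n∸m]≡n h≤m)
  by-cases (inj₂ m≤h) = begin
    36 * (s * s) + 60 * (s * m)                 ≤⟨ +-monoʳ-≤ (36 * (s * s)) (*-monoʳ-≤ 60 (*-monoʳ-≤ s m≤h)) ⟩
    36 * (s * s) + 60 * (s * h)                 ≤⟨ at-h ⟩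
    15 * (h * h) + 48 * Q                       ≤⟨ m≤m+n _ (15 * (d * d)) ⟩
    15 * (h * h) + 48 * Q + 15 * (d * d)        ≡⟨ cong (λ x → 15 * (x * x) + 48 * Q + 15 * (d * d)) h≡ ⟩
    15 * ((m + d) * (m + d)) + 48 * Q + 15 * (d * d)  ≡⟨ merge′ m d Q ⟩
    15 * (m * m) + (48 * Q + 30 * (d * (m + d)))  ≡⟨ cong (λ x → 15 * (m * m) + (48 * Q + 30 * (d * x))) h≡ ⟨
    15 * (m * m) + (48 * Q + 30 * (d * h))      ≤⟨ +-monoʳ-≤ (15 * (m * m)) (+-monoʳ-≤ (48 * Q)
                                                     (*-monoʳ-≤ 30 (*-monoˡ-≤ h (m≤n+o⇒m∸n≤o h m h≤m+g)))) ⟩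
    15 * (m * m) + (48 * Q + 30 * (g * h))      ∎
    where
    d = h ∸ m
    h≡ : h ≡ m + d
    h≡ = sym (m+[n∸m]≡n m≤h)

-- DDDO preserves 3t + b − 2a and changes the sign of 2a² − 4ab − 3b²; both vanish in the
-- direction where the repetition at the third D has s / n = √10 − 5/2.
record Near (e Q : ℕ) (v : Triple) : Set where
  constructor near
  a = proj₁ v
  b = proj₁ (proj₂ v)
  t = proj₂ (proj₂ v)
  field
    linear : 2 * a ≤ 3 * t + b + e
    lower  : 4 * (a * b) + 3 * (b * b) ≤ 2 * (a * a) + Q
    upper  : 2 * (a * a) ≤ 4 * (a * b) + 3 * (b * b) + Q

-- Tolerances generous enough for the triple itself. Their size is irrelevant: they stay fixed along
-- the periods while the triples grow.
nearBy : Triple → ℕ × ℕ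
nearBy (a , b , t) = 2 * a , 2 * (a * a) + (4 * (a * b) + 3 * (b * b))

near-refl : ∀ v → Near (proj₁ (nearBy v)) (proj₂ (nearBy v)) v
near-refl (a , b , t) = near (m≤n+m _ (3 * t + b))
  (≤-trans (m≤n+m _ (2 * (a * a))) (m≤n+m _ (2 * (a * a))))
  (≤-trans (m≤m+n _ (4 * (a * b) + 3 * (b * b))) (m≤n+m _ (4 * (a * b) + 3 * (b * b))))

DDDO : Triple → Triple
DDDO v = act O (act D (act D (act D v)))

-- The quadratic form changes sign, so `lower` and `upper` trade places. Each new inequality is an
-- old one with the same polynomial added to both sides.
near-DDDO : ∀ {e Q} v → Near e Q v → Near e Q (DDDO v)
near-DDDO {e} {Q} (a , b , t) (near lin lo up) = near
  (subst₂ _≤_ (l₁ a b) (l₂ a b t e) (+-monoʳ-≤ (8 * a + 6 * b) lin))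
  (subst₂ _≤_ (q₁ a b) (q₂ a b Q) (+-monoʳ-≤ (50 * (a * a) + 56 * (a * b) + 15 * (b * b)) up))
  (subst₂ _≤_ (q₃ a b) (q₄ a b Q) (+-monoʳ-≤ (50 * (a * a) + 56 * (a * b) + 15 * (b * b)) lo))
  where
  l₁ : ∀ a b → 8 * a + 6 * b + 2 * a ≡ 2 * (a + b + a + (a + b) + (a + b + a))
  l₁ = solve-∀
  l₂ : ∀ a b t e → 8 * a + 6 * b + (3 * t + b + e)
     ≡ 3 * (t + b + a + (a + b)) + (a + b + a) + e
  l₂ = solve-∀
  q₁ : ∀ a b → 50 * (a * a) + 56 * (a * b) + 15 * (b * b) + 2 * (a * a)
     ≡ 4 * ((a + b + a + (a + b) + (a + b + a)) * (a + b + a)) + 3 * ((a + b + a) * (a + b + a))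
  q₁ = solve-∀
  q₂ : ∀ a b Q → 50 * (a * a) + 56 * (a * b) + 15 * (b * b) + (4 * (a * b) + 3 * (b * b) + Q)
     ≡ 2 * ((a + b + a + (a + b) + (a + b + a)) * (a + b + a + (a + b) + (a + b + a))) + Q
  q₂ = solve-∀
  q₃ : ∀ a b → 50 * (a * a) + 56 * (a * b) + 15 * (b * b) + (4 * (a * b) + 3 * (b * b))
     ≡ 2 * ((a + b + a + (a + b) + (a + b + a)) * (a + b + a + (a + b) + (a + b + a)))
  q₃ = solve-∀
  q₄ : ∀ a b Q → 50 * (a * a) + 56 * (a * b) + 15 * (b * b) + (2 * (a * a) + Q)
     ≡ 4 * ((a + b + a + (a + b) + (a + b + a)) * (a + b + a)) + 3 * ((a + b + a) * (a + b + a)) + Q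
  q₄ = solve-∀

-- The surplus `n * n` is at least quadratic in `a + b`, whereas near the limit direction the error
-- from `near-root` is only linear in it. Hence a tight repetition forces `a + b` to be bounded.
bounded : ∀ {e Q} p q a b t n → AboveBound p q → Positive (a , b , t) → Near e Q (a , b , t) →
  2 + n ≡ t + (4 * a + 3 * b) → p * n ≤ q * (3 * a + 2 * b + n) →
  a + b ≤ q * q * (48 * Q + 420 * (6 + e))
bounded {e} {Q} p q a@(suc _) b@(suc _) t n above pos (near lin lo up) n≡ h =
  *-cancelʳ-≤ u (q * q * C) u (begin
    u * u                ≤⟨ *-mono-≤ u≤n u≤n ⟩
    n * n                ≤⟨ m≤n*m (n * n) 9 ⟩
    9 * (n * n)          ≤⟨ 9nn ⟩
    q * q * X            ≤⟨ *-monoʳ-≤ (q * q) X≤ ⟩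
    q * q * (C * u)      ≡⟨ *-assoc (q * q) C u ⟨
    q * q * C * u        ∎)
  where
  open ≤-Reasoning
  u = a + b
  -- `linear` gives `H ≤ 3 * (2 + n) + e`, so `H` exceeds `3 * n` by at most this; `near-root` is
  -- applied with `m = 3 * n`.
  g = 6 + e
  s = 3 * a + 2 * b
  H = 14 * a + 8 * b
  -- `H` is at most `14 * u`, and 30 · 14 = 420.
  C = 48 * Q + 420 * g
  X = 48 * Q + 30 * (g * H)
  u+ : ∀ a b t → t + (4 * (1 + a) + 3 * (1 + b)) ≡ 2 + ((1 + a) + (1 + b) + (t + 3 * a + 2 * b + 3))
  u+ = solve-∀
  u≤n : u ≤ n
  u≤n = +-cancelˡ-≤ 2 u n (subst (2 + u ≤_) (sym (trans n≡ (u+ (pred a) (pred b) t))) (s≤s (s≤s (m≤m+n u _))))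
  g-lhs : ∀ a b → 2 * a + (12 * a + 8 * b) ≡ 14 * a + 8 * b
  g-lhs = solve-∀
  g-mid : ∀ a b t e → 3 * t + b + e + (12 * a + 8 * b) ≡ 3 * (t + (4 * a + 3 * b)) + e
  g-mid = solve-∀
  g-rhs : ∀ n e → 3 * (2 + n) + e ≡ 3 * n + (6 + e)
  g-rhs = solve-∀
  H≤ : H ≤ 3 * n + g
  H≤ = subst₂ _≤_ (g-lhs a b) (trans (g-mid a b t e) (trans (cong (λ x → 3 * x + e) (sym n≡)) (g-rhs n e)))
         (+-monoˡ-≤ (12 * a + 8 * b) lin)
  nine : ∀ q n → 9 * (n * n + q * q * (15 * (n * n))) ≡ 9 * (n * n) + q * q * (15 * (3 * n * (3 * n)))
  nine = solve-∀
  nine′ : ∀ q s n → 9 * (q * q * (4 * (s * s) + 20 * (s * n))) ≡ q * q * (36 * (s * s) + 60 * (s * (3 * n)))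
  nine′ = solve-∀
  9nn : 9 * (n * n) ≤ q * q * X
  9nn = +-cancelʳ-≤ (q * q * (15 * (3 * n * (3 * n)))) _ _ (begin
    9 * (n * n) + q * q * (15 * (3 * n * (3 * n)))      ≡⟨ nine q n ⟨
    9 * (n * n + q * q * (15 * (n * n)))                ≤⟨ *-monoʳ-≤ 9 (tight⇒quadratic p q s n above h) ⟩
    9 * (q * q * (4 * (s * s) + 20 * (s * n)))          ≡⟨ nine′ q s n ⟩
    q * q * (36 * (s * s) + 60 * (s * (3 * n)))         ≤⟨ *-monoʳ-≤ (q * q) (near-root a b (3 * n) g Q H≤ lo) ⟩
    q * q * (15 * (3 * n * (3 * n)) + X)                ≡⟨ *-distribˡ-+ (q * q) (15 * (3 * n * (3 * n))) X ⟩
    q * q * (15 * (3 * n * (3 * n))) + q * q * X        ≡⟨ +-comm (q * q * (15 * (3 * n * (3 * n)))) _ ⟩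
    q * q * X + q * q * (15 * (3 * n * (3 * n)))        ∎)
  X+ : ∀ a b Q g → 48 * Q + 30 * (g * (14 * (1 + a) + 8 * (1 + b)))
       + (48 * Q * (1 + a + b) + 180 * (g * (1 + b)))
     ≡ (48 * Q + 420 * g) * (1 + a + (1 + b))
  X+ = solve-∀
  X≤ : X ≤ C * u
  X≤ = ≤-trans (m≤m+n X _) (≤-reflexive (X+ (pred a) (pred b) Q g))

-- Search for a good repetition.

module Search (z : ℕ → Bool) (uncrossed : Uncrossed z)
              (N p q : ℕ) (0<q : 0 < q) (above : AboveBound p q) where
  open Words z

  instance
    q-nonZero : NonZero q
    q-nonZero = >-nonZero 0<q

  q<p : q < p
  q<p = *-cancelˡ-< 50 q p (<-≤-trans (*-monoˡ-< q {50} {83} (<ᵇ⇒< 50 83 tt)) (above⇒1·66 p q above))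

  Good : Set
  Good = ∃[ n ] ∃[ i ] ∃[ s ] (N ≤ n × i < s × Agree z i s n × q * (s + n) < p * n)

  Tight : ℕ → ℕ → Set
  Tight s n = N ≤ n → p * n ≤ q * (s + n)

  infixl 1 _>>=_
  -- An exception monad: the search stops at the first good repetition, and otherwise goes on with
  -- the information that the repetition examined was not good.
  _>>=_ : ∀ {X Y : Set} → Good ⊎ X → (X → Good ⊎ Y) → Good ⊎ Y
  inj₁ g >>= f = inj₁ g
  inj₂ x >>= f = f x

  tight : ∀ {i s} n → i < s → Agree z i s n → Good ⊎ Tight s n
  tight {i} {s} n i<s h with N ≤? n | q * (s + n) <? p * n
  ... | yes N≤n | yes lt = inj₁ (n , i , s , N≤n , i<s , h , lt)
  ... | yes _   | no ≮   = inj₂ λ _ → ≮⇒≥ ≮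
  ... | no N≰n  | _      = inj₂ λ N≤n → contradiction N≤n N≰n

  -- A finite form of aperiodicity: if the coding agreed with its shift by `suc r` for long enough,
  -- the word would repeat a factor far longer than its position, which is good.
  breaks : ∀ σ r i → Good ⊎ ∃[ k ] State.y σ (i + k) ≢ State.y σ (suc r + (i + k))
  breaks σ r i with mismatch? (State.y σ) (suc i) (suc (i + suc r)) (N + suc (q * suc (State.E σ (i + suc r))))
  ... | inj₁ h = inj₁ (n , suc (E i) , s , m≤m+n N _ , s≤s (E-mono i r) , agree-blocks i (i + suc r) n h , large)
    where
    open State σ
    s = suc (E (i + suc r))
    -- Chosen above `q * s`: since `p` is at least `q + 1`, this already gives
    -- `q * (s + n) < p * n`.
    n = N + suc (q * s)
    open ≤-Reasoning
    large : q * (s + n) < p * n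
    large = begin-strict
      q * (s + n)    ≡⟨ *-distribˡ-+ q s n ⟩
      q * s + q * n  <⟨ +-monoˡ-< (q * n) (m≤n+m (suc (q * s)) N) ⟩
      n + q * n      ≤⟨ *-monoˡ-≤ n q<p ⟩
      p * n          ∎
  ... | inj₂ (k , ≢) = inj₂ (suc k , λ eq → ≢ (begin
      y (suc i + k)                ≡⟨ cong y (+-suc i k) ⟨
      y (i + suc k)                ≡⟨ eq ⟩
      y (suc r + (i + suc k))      ≡⟨ cong y (+-comm (suc r) (i + suc k)) ⟩
      y (i + suc k + suc r)        ≡⟨ cong (λ m → y (m + suc r)) (+-suc i k) ⟩
      y (suc (i + k + suc r))      ≡⟨ cong (λ m → y (suc m)) (trans (+-assoc i k (suc r))
                                        (trans (cong (i +_) (+-comm k (suc r))) (sym (+-assoc i (suc r) k)))) ⟩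
      y (suc (i + suc r) + k)      ∎))
    where
    open State σ
    open ≡-Reasoning

  Occurs : State → Bool → Bool → Set
  Occurs σ c d = ∃[ i ] (y i ≡ c × y (suc i) ≡ d)
    where open State σ

  -- A mismatch with the shift by 1 is a change of letter. Given one change and another one later,
  -- the opposite change happens between them or is the later one.
  changes : ∀ σ → Good ⊎ (∀ c → Occurs σ c (not c))
  changes σ = do
    m , m≢ ← breaks σ 0 0
    k , k≢ ← breaks σ 0 (suc m)
    inj₂ (occurs m m≢ k k≢)
    where
    open State σ
    back : ∀ m → y m ≢ y (suc m) → ∀ k → y (suc m + k) ≢ y (suc (suc m + k)) →
           Occurs σ (not (y m)) (y m)
    back m m≢ k k≢ with y (suc m + k) Bool.≟ y m
    ... | yes eq = rise y (y m) (suc m) k (Bool.¬-not (≢-sym m≢)) eq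
    ... | no neq = suc m + k , Bool.¬-not neq ,
      trans (Bool.¬-not (≢-sym k≢)) (trans (cong not (Bool.¬-not neq)) (Bool.not-involutive (y m)))
    occurs : ∀ m → y m ≢ y (suc m) → ∀ k → y (suc m + k) ≢ y (suc (suc m + k)) →
             ∀ c → Occurs σ c (not c)
    occurs m m≢ k k≢ c with c Bool.≟ y m
    ... | yes refl = m , refl , Bool.¬-not (≢-sym m≢)
    ... | no neq with refl ← Bool.¬-not neq =
      subst (Occurs σ _) (sym (Bool.not-involutive (y m))) (back m m≢ k k≢)

  -- A mismatch with the shift by 2 rules out alternation: the letter in the middle equals one of
  -- its two neighbours.
  doubled : ∀ σ → Good ⊎ ∃[ c ] Occurs σ c c
  doubled σ = do
    j , j≢ ← breaks σ 1 0
    inj₂ (double j j≢)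
    where
    open State σ
    double : ∀ j → y j ≢ y (2 + j) → ∃[ c ] Occurs σ c c
    double j j≢ with y (suc j) Bool.≟ y j
    ... | yes eq = y j , j , refl , eq
    ... | no neq = y (suc j) , suc j , refl , trans (Bool.¬-not (≢-sym j≢)) (sym (Bool.¬-not neq))

  -- If both letters were doubled, then together with the two changes all four pairs would occur in
  -- the coding, that is, all four two-sided extensions of `w`, against `uncrossed`.
  isolated : ∀ σ → Good ⊎ ∃[ c ] Isolates σ c
  isolated σ = do
    occ ← changes σ
    c , dbl ← doubled σ
    inj₂ (c , isolates occ dbl)
    where
    open State σ
    isolates : (∀ c → Occurs σ c (not c)) → ∀ {c} → Occurs σ c c → Isolates σ c
    isolates occ {c} dbl i yi with y (suc i) Bool.≟ c
    ... | yes eq = eq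
    ... | no neq = ⊥-elim (uncrossed ℓ (λ d d′ → E (proj₁ (all d d′)))
                     (λ d d′ → proj₁ (proj₂ (all d d′)))
                     (λ d d′ → trans (after _) (proj₂ (proj₂ (all d d′))))
                     (λ d d′ → bisp _ _))
      where
      twice : ∀ d → Occurs σ d d
      twice d with d Bool.≟ c
      ... | yes refl = dbl
      ... | no d≢c with refl ← Bool.¬-not d≢c = i , yi , Bool.¬-not neq
      all : ∀ d d′ → Occurs σ d d′
      all d d′ with d′ Bool.≟ d
      ... | yes refl = twice d
      ... | no d′≢d with refl ← Bool.¬-not d′≢d = occ d

  -- Repetitions exhibited by each move.

  shape : State → Triple
  shape σ = len (y 0) , len (not (y 0)) , suc (E 0)
    where open State σ

  -- The repetitions with `s = t + b` are the first two occurrences of `w`, of length `a + b` minus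
  -- 2. The others are a prefix of the word, namely the cut block and the `w` after it, recurring at
  -- `s`. Writing `2 + n` avoids truncated subtraction.
  Raw : Move → Triple → Set
  Raw S (a , b , t) = ∀ n → 2 + n ≡ t + (a + b) → Tight a n
  Raw D (a , b , t) = (∀ n → 2 + n ≡ a + b → Tight (t + b) n)
                    × (∀ n → 2 + n ≡ t + (a + b) → Tight (a + b) n)
  Raw O (a , b , t) = ∀ n → 2 + n ≡ a + b → Tight (t + b) n

  record Link (σ : State) (m : Move) (σ′ : State) : Set where
    constructor link
    field
      shape-act : shape σ′ ≡ act m (shape σ)
      raw       : Raw m (shape σ)

  module _ (σ : State) where
    open State σ

    prefix-match : ∀ {j s} → y 0 ≡ y j → E j ≡ s + E 0 → Agree z 0 s (suc (E 0) + ℓ)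
    prefix-match {j} {s} p eq with d , eq′ , h ← first j p
                              with refl ← +-cancelʳ-≡ (E 0) d s (trans (sym eq′) eq) =
      agree-++ (suc (E 0)) h (subst (λ m → Agree z (suc (E 0)) m ℓ)
        (trans (cong suc eq) (sym (+-suc s (E 0)))) (bisp 0 j))

    tight-repeat : ∀ {j} s → 0 < s → y 0 ≡ y j → E j ≡ s + E 0 →
      Good ⊎ (∀ n → 2 + n ≡ suc (E 0) + (len (y 0) + len (not (y 0))) → Tight s n)
    tight-repeat s 0<s p eq = do
      T ← tight (suc (E 0) + ℓ) 0<s (prefix-match p eq)
      inj₂ λ n n≡ → subst (Tight s) (suc-injective (suc-injective (begin
        2 + (suc (E 0) + ℓ)  ≡⟨ +-comm 2 (suc (E 0) + ℓ) ⟩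
        suc (E 0) + ℓ + 2    ≡⟨ +-assoc (suc (E 0)) ℓ 2 ⟩
        suc (E 0) + (ℓ + 2)  ≡⟨ cong (suc (E 0) +_) (trans (+-comm ℓ 2) (sym (len-ℓ (y 0)))) ⟩
        suc (E 0) + (len (y 0) + len (not (y 0))) ≡⟨ n≡ ⟨
        2 + n                ∎))) T
      where open ≡-Reasoning

    tight-bispecial : y 1 ≡ not (y 0) →
      Good ⊎ (∀ n → 2 + n ≡ len (y 0) + len (not (y 0)) → Tight (suc (E 0) + len (not (y 0))) n)
    tight-bispecial p = do
      T ← tight ℓ (s≤s (E-step 0)) (bisp 0 1)
      inj₂ λ n n≡ → subst₂ Tight (sym (next′ 0 p))
        (suc-injective (suc-injective (trans (sym (len-ℓ (y 0))) (sym n≡)))) T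

  -- Comparing `y 0` and `y 1` with the doubled letter `c` decides the move. If `y 0` is not `c`,
  -- isolation forces `y 1` to be `c`, so three cases remain.
  step : ∀ σ → Good ⊎ ∃[ m ] ∃[ σ′ ] Link σ m σ′
  step σ = isolated σ >>= λ (c , iso) → by-cases c iso
    where
    open State σ
    by-cases : ∀ c → Isolates σ c → Good ⊎ ∃[ m ] ∃[ σ′ ] Link σ m σ′
    by-cases c iso with y 0 Bool.≟ c | y 1 Bool.≟ c
    ... | yes refl | yes y1 = do
      T ← tight-repeat σ {1} (len (y 0)) (len≥1 _) (sym y1)
            (trans (next 0) (trans (cong (λ d → E 0 + len d) y1) (+-comm (E 0) _)))
      inj₂ (S , derived , link (cong₂ _,_ (trans (cong len′ ye0) (len′-c refl))
        (cong₂ _,_ (trans (cong (λ d → len′ (not d)) ye0) (len′-not refl)) (cong (λ k → suc (E k)) e0))) T)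
      where
      open Derived σ c iso
      e0 : e 0 ≡ 0
      e0 = skip-c y1
      ye0 : y (e 0) ≡ c
      ye0 = cong y e0
    ... | yes refl | no y1≢c = do
      T₁ ← tight-bispecial σ y1
      T₂ ← tight-repeat σ {2} (len (y 0) + len (not (y 0))) (≤-trans (len≥1 _) (m≤m+n _ _)) (sym y2) E2
      inj₂ (D , derived , link (cong₂ _,_ (len′-not ye0)
        (cong₂ _,_ (len′-c (trans (cong not ye0) (Bool.not-involutive c)))
                   (trans (cong (λ k → suc (E k)) e0) (sym (next′ 0 y1))))) (T₁ , T₂))
      where
      open Derived σ c iso
      y1 : y 1 ≡ not (y 0)
      y1 = Bool.¬-not y1≢c
      y2 : y 2 ≡ y 0
      y2 = iso 1 y1
      e0 : e 0 ≡ 1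
      e0 = skip-not y1
      ye0 : y (e 0) ≡ not c
      ye0 = trans (cong y e0) y1
      open ≡-Reasoning
      E2 : E 2 ≡ len (y 0) + len (not (y 0)) + E 0
      E2 = begin
        E 2                                      ≡⟨ next 1 ⟩
        E 1 + len (y 2)                          ≡⟨ cong₂ (λ m d → m + len d) (next 0) y2 ⟩
        E 0 + len (y 1) + len (y 0)              ≡⟨ cong (λ d → E 0 + len d + len (y 0)) y1 ⟩
        E 0 + len (not (y 0)) + len (y 0)        ≡⟨ +-assoc (E 0) _ _ ⟩
        E 0 + (len (not (y 0)) + len (y 0))      ≡⟨ +-comm (E 0) _ ⟩
        len (not (y 0)) + len (y 0) + E 0        ≡⟨ cong (_+ E 0) (+-comm (len (not (y 0))) _) ⟩
        len (y 0) + len (not (y 0)) + E 0        ∎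
    ... | no y0≢c | _ with refl ← trans (sym (Bool.not-involutive c)) (cong not (sym (Bool.¬-not y0≢c))) = do
      T ← tight-bispecial σ y1
      inj₂ (O , derived , link (cong₂ _,_
        (trans (len′-not (trans ye0 y0))
               (trans (cong (len c +_) (cong len (sym y0))) (+-comm (len c) _)))
        (cong₂ _,_ (trans (cong (λ d → len′ (not d)) ye0) (len′-c refl))
                   (cong (λ k → suc (E k)) e0))) T)
      where
      open Derived σ c iso
      y0 : y 0 ≡ not c
      y0 = sym (Bool.not-involutive (y 0))
      y1 : y 1 ≡ not (y 0)
      y1 = iso 0 y0
      e0 : e 0 ≡ 0
      e0 = skip-c y1
      ye0 : y (e 0) ≡ y 0
      ye0 = cong y e0

  -- `above⇒1·66` yields `33 * n ≤ 50 * s`. As 23 · 33 = 759 exceeds 15 · 50 = 750, the margin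
  -- `9 * n` absorbs the 1500 due to the shift by 2 once `n` is at least 168.
  tight⇒coarse : ∀ {s} n → Tight s n → N + 168 ≤ n → 15 * (2 + n) ≤ 23 * s
  tight⇒coarse {s} n T N+168≤n = *-cancelˡ-≤ 50 (begin
    50 * (15 * (2 + n))            ≡⟨ numerals n ⟩
    750 * n + 1500                 ≤⟨ +-monoʳ-≤ (750 * n) (≤-trans (≤ᵇ⇒≤ 1500 (9 * 168) tt)
                                        (*-monoʳ-≤ 9 (≤-trans (m≤n+m 168 N) N+168≤n))) ⟩
    750 * n + 9 * n                ≡⟨ numerals′ n ⟩
    23 * (33 * n)                  ≤⟨ *-monoʳ-≤ 23 33n≤50s ⟩
    23 * (50 * s)                  ≡⟨ swap s ⟩
    50 * (23 * s)                  ∎)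
    where
    open ≤-Reasoning
    numerals : ∀ n → 50 * (15 * (2 + n)) ≡ 750 * n + 1500
    numerals = solve-∀
    numerals′ : ∀ n → 750 * n + 9 * n ≡ 23 * (33 * n)
    numerals′ = solve-∀
    swap : ∀ s → 23 * (50 * s) ≡ 50 * (23 * s)
    swap = solve-∀
    lhs : ∀ q n → q * (83 * n) ≡ 83 * q * n
    lhs = solve-∀
    mid : ∀ p n → 50 * p * n ≡ 50 * (p * n)
    mid = solve-∀
    rhs : ∀ q s n → 50 * (q * (s + n)) ≡ q * (50 * s + 50 * n)
    rhs = solve-∀
    split : ∀ n → 33 * n + 50 * n ≡ 83 * n
    split = solve-∀
    33n≤50s : 33 * n ≤ 50 * s
    33n≤50s = +-cancelʳ-≤ (50 * n) _ _ (*-cancelˡ-≤ q (begin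
      q * (33 * n + 50 * n)  ≡⟨ cong (q *_) (split n) ⟩
      q * (83 * n)           ≡⟨ lhs q n ⟩
      83 * q * n             ≤⟨ *-monoˡ-≤ n (above⇒1·66 p q above) ⟩
      50 * p * n             ≡⟨ mid p n ⟩
      50 * (p * n)           ≤⟨ *-monoʳ-≤ 50 (T (≤-trans (m≤m+n N 168) N+168≤n)) ⟩
      50 * (q * (s + n))     ≡⟨ rhs q s n ⟩
      q * (50 * s + 50 * n)  ∎))

  Late : Triple → Set
  Late v = 2 + (N + 168) ≤ size v

  coarse : ∀ m v → Late v → Raw m v → Coarse m v
  coarse m (a , b , t) late = go m
    where
    from-tight : ∀ s x → 2 + (N + 168) ≤ x → (∀ n → 2 + n ≡ x → Tight s n) → 15 * x ≤ 23 * s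
    from-tight s (suc (suc n)) (s≤s (s≤s le)) T = tight⇒coarse n (T n refl) le
    late′ : 2 + (N + 168) ≤ t + (a + b)
    late′ = ≤-trans late (m≤n+m (a + b) t)
    go : ∀ m → Raw m (a , b , t) → Coarse m (a , b , t)
    go S T         = from-tight a (t + (a + b)) late′ T
    go D (T₁ , T₂) = from-tight (t + b) (a + b) late T₁ , from-tight (a + b) (t + (a + b)) late′ T₂
    go O T         = from-tight (t + b) (a + b) late T

  shape-positive : ∀ σ → Positive (shape σ)
  shape-positive σ = positive (len≥1 _) (len≥1 _)
    where open State σ

  size-act : ∀ m v → Positive v → size v < size (act m v)
  size-act S (a , b , t) (positive p q) = m<n+m (a + b) p
  size-act D (a , b , t) (positive p q) = m<m+n (a + b) p
  size-act O (a , b , t) (positive p q) = m<m+n (a + b) q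

  size-link : ∀ {σ m σ′} → Link σ m σ′ → size (shape σ) < size (shape σ′)
  size-link {σ} {m} (link eq _) =
    subst (λ v → size (shape σ) < size v) (sym eq) (size-act m (shape σ) (shape-positive σ))

  infixl 5 _▸_
  data Trace (σ : State) : List Move → State → Set where
    []  : Trace σ [] σ
    _▸_ : ∀ {h m σ′ σ″} → Trace σ h σ′ → Link σ′ m σ″ → Trace σ (m ∷ h) σ″

  size-trace : ∀ {σ h σ′} → Trace σ h σ′ → size (shape σ) ≤ size (shape σ′)
  size-trace []       = ≤-refl
  size-trace (tr ▸ l) = ≤-trans (size-trace tr) (<⇒≤ (size-link l))

  shape-trace : ∀ {σ h σ′} → Trace σ h σ′ → shape σ′ ≡ evals (formsAfter h) (shape σ)
  shape-trace {σ} [] = identity (shape σ)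
    where
    first : ∀ a b t → a ≡ 1 * a + 0 * b + 0 * t
    first = solve-∀
    second : ∀ a b t → b ≡ 0 * a + 1 * b + 0 * t
    second = solve-∀
    third : ∀ a b t → t ≡ 0 * a + 0 * b + 1 * t
    third = solve-∀
    identity : ∀ v → v ≡ evals (formsAfter []) v
    identity (a , b , t) = cong₂ _,_ (first a b t) (cong₂ _,_ (second a b t) (third a b t))
  shape-trace {σ} (_▸_ {h} {m} tr (link eq _)) =
    trans eq (trans (cong (act m) (shape-trace tr)) (sym (evals-actF m (formsAfter h) (shape σ))))

  rows-trace : ∀ {rs σ h σ′} → Late (shape σ) → All (Holds (shape σ)) rs → Trace σ h σ′ →
               All (Holds (shape σ)) (rowsAfter rs h)
  rows-trace late base [] = base
  rows-trace {σ = σ} late base (_▸_ {h} {m} tr (link _ raw)) = ++⁺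
    (rows-hold m (formsAfter h) (shape σ) (subst (Coarse m) (shape-trace tr)
      (coarse m _ (≤-trans late (size-trace tr)) raw)))
    (rows-trace late base tr)

  module _ {P : List Move → Set} (P? : ∀ h → Dec (P h)) {rs σ₀}
           (late : Late (shape σ₀)) (base : All (Holds (shape σ₀)) rs) where

    -- The tree is descended along the moves that the word itself makes; a certificate refutes a
    -- dead branch with the inequalities collected on the way.
    explore : ∀ T {h σ} → Certified P? rs T h → Trace σ₀ h σ →
              Good ⊎ ∃[ h′ ] ∃[ σ′ ] (P h′ × Trace σ₀ h′ σ′)
    explore (dead ks) {h} cert tr = ⊥-elim (absurd (combine ks (rowsAfter rs h)) (shape σ₀)
      (shape-positive σ₀) cert
      (combine-holds (shape σ₀) ks (rowsAfter rs h) (rows-trace late base tr)))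
    explore leaf cert tr = inj₂ (_ , _ , cert , tr)
    explore (node s d o) {σ = σ} (certS , certD , certO) tr = step σ >>= λ where
      (S , _ , l) → explore s certS (tr ▸ l)
      (D , _ , l) → explore d certD (tr ▸ l)
      (O , _ , l) → explore o certO (tr ▸ l)

  grow : ∀ k → Good ⊎ ∃[ σ ] 2 + k ≤ size (shape σ)
  grow zero    = inj₂ (initial , ≤-refl)
  grow (suc k) = do
    σ , big ← grow k
    _ , σ′ , l ← step σ
    inj₂ (σ′ , ≤-<-trans big (size-link l))

  -- Reaching the periodic regime.

  Settled : Triple → Set
  Settled v@(a , b , t) = Late v × b ≤ a × 15 * a ≤ 23 * (t + b)

  settled-D : ∀ {σ σ′} → Late (shape σ) → Link σ D σ′ → Settled (shape σ′)
  settled-D {σ} {σ′} late l@(link eq raw) = subst Settled (sym eq)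
    (subst Late eq (≤-trans late (<⇒≤ (size-link l))) , m≤m+n _ _ ,
     ≤-trans (proj₁ (coarse D (shape σ) late raw))
       (*-monoʳ-≤ 23 (m≤m+n (suc (E 0) + len (not (y 0))) (len (y 0)))))
    where open State σ

  settled-O : ∀ {σ σ′} → Late (shape σ) → Link σ O σ′ → Settled (shape σ′)
  settled-O {σ} {σ′} late l@(link eq raw) = subst Settled (sym eq)
    (subst Late eq (≤-trans late (<⇒≤ (size-link l))) , m≤n+m _ _ , coarse O (shape σ) late raw)

  -- Two moves S in a row are contradictory: the second would give `15 * (t + 2 * a + b) ≤ 23 * a`.
  -- So D or O comes within two moves, and either one settles the triple.
  settle : Good ⊎ ∃[ σ ] Settled (shape σ)
  settle = do
    σ , late ← grow (N + 168)
    step σ >>= λ where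
      (D , σ′ , l) → inj₂ (σ′ , settled-D late l)
      (O , σ′ , l) → inj₂ (σ′ , settled-O late l)
      (S , σ′ , l) → step σ′ >>= λ where
        (D , σ″ , l′) → inj₂ (σ″ , settled-D (≤-trans late (<⇒≤ (size-link l))) l′)
        (O , σ″ , l′) → inj₂ (σ″ , settled-O (≤-trans late (<⇒≤ (size-link l))) l′)
        (S , σ″ , l′) → ⊥-elim (absurd (combine (1 ∷ []) (rowsAfter [] (S ∷ S ∷ [])))
          (shape σ) (shape-positive σ)
          (toWitness {a? = absurd? (combine (1 ∷ []) (rowsAfter [] (S ∷ S ∷ [])))} tt)
          (combine-holds (shape σ) (1 ∷ []) _ (rows-trace late [] ([] ▸ l ▸ l′))))

  Balanced : Triple → Set
  Balanced v@(a , b , t) = Late v × b ≤ a × a ≤ 2 * b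

  -- S would give `15 * (t + b) ≤ 8 * a`; combined with `15 * a ≤ 23 * (t + b)` this means 225 ≤
  -- 184.
  ¬settled-S : ∀ v → Positive v → Settled v → ¬ Coarse S v
  ¬settled-S (suc a , b , t) _ (_ , _ , p) q = <-irrefl refl (begin-strict
    184 * suc a                      <⟨ *-monoˡ-< (suc a) {184} {225} (<ᵇ⇒< 184 225 tt) ⟩
    225 * suc a                      ≡⟨ *-assoc 15 15 (suc a) ⟩
    15 * (15 * suc a)                ≤⟨ *-monoʳ-≤ 15 p ⟩
    15 * (23 * (t + b))              ≡⟨ regroup (t + b) ⟩
    23 * (15 * (t + b))              ≤⟨ *-monoʳ-≤ 23 (+-cancelʳ-≤ (15 * suc a) (15 * (t + b)) (8 * suc a) (begin
        15 * (t + b) + 15 * suc a      ≡⟨ collect a b t ⟩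
        15 * (t + (suc a + b))         ≤⟨ q ⟩
        23 * suc a                     ≡⟨ *-distribʳ-+ (suc a) 8 15 ⟩
        8 * suc a + 15 * suc a         ∎)) ⟩
    23 * (8 * suc a)                 ≡⟨ *-assoc 23 8 (suc a) ⟨
    184 * suc a                      ∎)
    where
    open ≤-Reasoning
    regroup : ∀ x → 15 * (23 * x) ≡ 23 * (15 * x)
    regroup = solve-∀
    collect : ∀ a b t → 15 * (t + b) + 15 * (1 + a) ≡ 15 * (t + (1 + a + b))
    collect = solve-∀

  -- Shows that the measure `2 * (t + b)` minus `a`, which decreases in `balance`, cannot run out.
  settled-a< : ∀ v → Positive v → Settled v → ¬ 2 * (proj₂ (proj₂ v) + proj₁ (proj₂ v)) ≤ proj₁ v + 0
  settled-a< (a , suc b , t) _ (_ , _ , p) h = <-irrefl refl (begin-strict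
    23 * (t + suc b)        <⟨ *-monoˡ-< (t + suc b) {{>-nonZero (≤-trans (s≤s z≤n) (m≤n+m (suc b) t))}}
                                 {23} {30} (<ᵇ⇒< 23 30 tt) ⟩
    30 * (t + suc b)        ≡⟨ *-assoc 15 2 (t + suc b) ⟩
    15 * (2 * (t + suc b))  ≤⟨ *-monoʳ-≤ 15 h ⟩
    15 * (a + 0)            ≡⟨ cong (15 *_) (+-identityʳ a) ⟩
    15 * a                  ≤⟨ p ⟩
    23 * (t + suc b)        ∎)
    where open ≤-Reasoning

  balance-step : ∀ k v → Positive v → 2 * (proj₂ (proj₂ v) + proj₁ (proj₂ v)) ≤ proj₁ v + suc k →
         2 * (proj₂ (proj₂ v) + proj₁ (proj₂ v)) ≤ proj₁ v + proj₁ (proj₂ v) + k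
  balance-step k (a , b , t) (positive _ b≥1) h = ≤-trans h
    (≤-trans (+-monoʳ-≤ a (+-monoˡ-≤ k b≥1)) (≤-reflexive (sym (+-assoc a b k))))

  -- A run of moves O keeps t and b while a grows, which the bound 15 a ≤ 23 (t + b) limits.
  balance : ∀ k σ → Settled (shape σ) →
            2 * (proj₂ (proj₂ (shape σ)) + proj₁ (proj₂ (shape σ))) ≤ proj₁ (shape σ) + k →
            Good ⊎ ∃[ σ′ ] Balanced (shape σ′)
  balance zero σ st h = ⊥-elim (settled-a< (shape σ) (shape-positive σ) st h)
  balance (suc k) σ st@(late , b≤a , p) h = step σ >>= λ where
    (S , _ , link _ raw) → ⊥-elim (¬settled-S (shape σ) (shape-positive σ) st (coarse S (shape σ) late raw))
    -- After D the new `b` is the old `a`, and the new `a` is `a + b`, at most twice the old `a`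
    -- because `b ≤ a`.
    (D , σ′ , l@(link eq _)) → inj₂ (σ′ , subst Balanced (sym eq)
      (subst Late eq (≤-trans late (<⇒≤ (size-link l))) , m≤m+n _ _ ,
       +-monoʳ-≤ (proj₁ (shape σ)) (≤-trans b≤a (≤-reflexive (sym (+-identityʳ _))))))
    (O , σ′ , l@(link eq _)) → balance k σ′ (settled-O late l)
      (subst (λ { (a , b , t) → 2 * (t + b) ≤ a + k }) (sym eq) (balance-step k (shape σ) (shape-positive σ) h))

  -- Following the period until the size exceeds its bound.

  record Period (v : Triple) : Set where
    constructor mkPeriod
    field
      {start end} : State
      shape-start : shape start ≡ v
      late        : Late v
      trace       : Trace start period end

  entries : ∀ a b t → eval (0 , 1 , 0) (a , b , t) ≡ b × eval (1 , 0 , 0) (a , b , t) ≡ a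
                    × eval (0 , 0 , 1) (a , b , t) ≡ t × eval (0 , 2 , 0) (a , b , t) ≡ 2 * b
  entries a b t = e₁ a b t , e₂ a b t , e₃ a b t , e₄ a b t
    where
    e₁ : ∀ a b t → 0 * a + 1 * b + 0 * t ≡ b
    e₁ = solve-∀
    e₂ : ∀ a b t → 1 * a + 0 * b + 0 * t ≡ a
    e₂ = solve-∀
    e₃ : ∀ a b t → 0 * a + 0 * b + 1 * t ≡ t
    e₃ = solve-∀
    e₄ : ∀ a b t → 0 * a + 2 * b + 0 * t ≡ 2 * b
    e₄ = solve-∀

  loopRows-hold : ∀ σ → All (Holds (shape σ)) loopRows
  loopRows-hold σ
    with _ , e₂ , e₃ , _ ← entries (proj₁ (shape σ)) (proj₁ (proj₂ (shape σ))) (proj₂ (proj₂ (shape σ))) =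
    subst₂ _≤_ (sym e₃) (sym e₂) (State.cut σ) ∷ []

  startRows-hold : ∀ σ → Balanced (shape σ) → All (Holds (shape σ)) startRows
  startRows-hold σ (_ , b≤a , a≤2b)
    with e₁ , e₂ , _ , e₄ ← entries (proj₁ (shape σ)) (proj₁ (proj₂ (shape σ))) (proj₂ (proj₂ (shape σ))) =
    subst₂ _≤_ (sym e₁) (sym e₂) b≤a ∷ subst₂ _≤_ (sym e₂) (sym e₄) a≤2b ∷ loopRows-hold σ

  firstPeriod : ∀ σ → Balanced (shape σ) → Good ⊎ ∃ Period
  firstPeriod σ bal@(late , _) = do
    h , _ , ends , tr ← explore endsWithPeriod? late (startRows-hold σ bal) startTree start-certified []
    inj₂ (last (drop 4 h) (subst (λ h → Trace σ h _) ends tr))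
    where
    last : ∀ h {σ′} → Trace σ (period ++ h) σ′ → ∃ Period
    last h (tr ▸ l₁ ▸ l₂ ▸ l₃ ▸ l₄) =
      _ , mkPeriod refl (≤-trans late (size-trace tr)) ([] ▸ l₁ ▸ l₂ ▸ l₃ ▸ l₄)

  trace-period : ∀ {σ σ′} → Trace σ period σ′ → shape σ′ ≡ DDDO (shape σ)
  trace-period ([] ▸ link e₁ _ ▸ link e₂ _ ▸ link e₃ _ ▸ link e₄ _) =
    trans e₄ (cong (act O) (trans e₃ (cong (act D) (trans e₂ (cong (act D) e₁)))))

  -- The search resumes after the stored moves of the present period, whose rows the certificates of
  -- `loopTree` use. Only the second period is kept, re-based at its own start.
  nextPeriod : ∀ v → Period v → Good ⊎ Period (DDDO v)
  nextPeriod _ (mkPeriod {σ} refl late tr) = do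
    _ , _ , refl , tr′ ← explore twoPeriods? late (loopRows-hold σ) loopTree loop-certified tr
    inj₂ (second tr′)
    where
    second : ∀ {σ′} → Trace σ (period ++ period) σ′ → Period (DDDO (shape σ))
    second (tr ▸ l₁ ▸ l₂ ▸ l₃ ▸ l₄) = mkPeriod (trace-period tr)
      (subst Late (trace-period tr) (≤-trans late (size-trace tr))) ([] ▸ l₁ ▸ l₂ ▸ l₃ ▸ l₄)

  -- Applies `bounded` to the second repetition at the third D, whose `a + b` is `3 * a + 2 * b` in
  -- terms of the triple at the start of the period.
  period-bounded : ∀ {e Q} v → Near e Q v → Period v → size v ≤ q * q * (48 * Q + 420 * (6 + e))
  period-bounded _ nr (mkPeriod {σ} refl late ([] ▸ link e₁ _ ▸ link e₂ _ ▸ link e₃ raw ▸ _)) =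
    go (shape σ) (shape-positive σ) late nr (proj₂ (subst (Raw D) (trans e₂ (cong (act D) e₁)) raw))
    where
    go : ∀ {e Q} v → Positive v → Late v → Near e Q v →
         (let a , b , t = v in ∀ n → 2 + n ≡ t + b + a + (a + b + a + (a + b)) →
            Tight (a + b + a + (a + b)) n) →
         size v ≤ q * q * (48 * Q + 420 * (6 + e))
    go v@(a , b , t) pos late nr T = bounded p q a b t n above pos nr n≡
      (subst (λ s → p * n ≤ q * (s + n)) (s≡ a b) (T n (trans n≡ (total a b t)) N≤n))
      where
      total : ∀ a b t → t + (4 * a + 3 * b) ≡ t + b + a + (a + b + a + (a + b))
      total = solve-∀
      s≡ : ∀ a b → a + b + a + (a + b) ≡ 3 * a + 2 * b
      s≡ = solve-∀
      more : ∀ a b t → a + b + (t + 3 * a + 2 * b) ≡ t + (4 * a + 3 * b)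
      more = solve-∀
      n = t + (4 * a + 3 * b) ∸ 2
      big : 2 + (N + 168) ≤ t + (4 * a + 3 * b)
      big = ≤-trans late (≤-trans (m≤m+n (a + b) _) (≤-reflexive (more a b t)))
      n≡ : 2 + n ≡ t + (4 * a + 3 * b)
      n≡ = m+[n∸m]≡n (≤-trans (m≤m+n 2 (N + 168)) big)
      N≤n : N ≤ n
      N≤n = ≤-trans (m≤m+n N 168) (+-cancelˡ-≤ 2 (N + 168) n (≤-trans big (≤-reflexive (sym n≡))))

  size-DDDO : ∀ v → Positive v → size v < size (DDDO v)
  size-DDDO (a , b , t) (positive p _) = subst (a + b <_) (grown a b) (m<m+n (a + b) (≤-trans p (m≤m+n a _)))
    where
    grown : ∀ a b → a + b + (a + (5 * a + 3 * b)) ≡ a + b + a + (a + b) + (a + b + a) + (a + b + a)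
    grown = solve-∀

  -- Each period enlarges the size by at least 1 and keeps `e` and `Q`, so after `k` periods without
  -- a good repetition the size would exceed the bound of `period-bounded`.
  chase : ∀ {e Q} k v → Near e Q v → Period v → q * q * (48 * Q + 420 * (6 + e)) < k + size v → Good
  chase zero    v nr per big = ⊥-elim (<⇒≱ big (period-bounded v nr per))
  chase (suc k) v nr per big with nextPeriod v per
  ... | inj₁ good = good
  ... | inj₂ per′ = chase k (DDDO v) (near-DDDO v nr) per′
    (<-≤-trans big (≤-trans (≤-reflexive (sym (+-suc k (size v)))) (+-monoʳ-≤ k (size-DDDO v
      (subst Positive (Period.shape-start per) (shape-positive (Period.start per)))))))

  good : Good
  good with (settle >>= λ (σ , st) → balance _ σ st (m≤n+m _ (proj₁ (shape σ)))
                    >>= λ (σ′ , bal) → firstPeriod σ′ bal)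
  ... | inj₁ g         = g
  ... | inj₂ (v , per) = let e , Q = nearBy v in
    chase (suc (q * q * (48 * Q + 420 * (6 + e)))) v (near-refl v) per (m≤m+n _ (size v))

-- Counting factors by positions.

module Factors {k : ℕ} (x : Word k) where

  window : ℕ → ∀ n → Vec (Fin k) n
  window i n = tabulate λ j → x (i + toℕ j)

  window-agree : ∀ {i j} n → window i n ≡ window j n → Agree x i j n
  window-agree {i} {j} n eq = agree λ l l<n → begin
    x (i + l)                          ≡⟨ at-window i l<n ⟨
    lookup (window i n) (fromℕ< l<n)   ≡⟨ cong (λ w → lookup w (fromℕ< l<n)) eq ⟩
    lookup (window j n) (fromℕ< l<n)   ≡⟨ at-window j l<n ⟩
    x (j + l)                          ∎
    where
    open ≡-Reasoning
    at-window : ∀ i {l} (l<n : l < n) → lookup (window i n) (fromℕ< l<n) ≡ x (i + l)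
    at-window i l<n = trans (lookup∘tabulate _ (fromℕ< l<n)) (cong (λ m → x (i + m)) (toℕ-fromℕ< l<n))

  agree-window : ∀ {i j} n → Agree x i j n → window i n ≡ window j n
  agree-window n p = tabulate-cong λ j → at p (toℕ j) (toℕ<n j)

  module _ {n c} (complexity : Complexity x n c) where

    private
      f = proj₁ complexity
      f-injective = proj₁ (proj₂ complexity)
      f-factor = proj₁ (proj₂ (proj₂ complexity))
      f-complete = proj₂ (proj₂ (proj₂ complexity))

    position : Fin c → ℕ
    position r = proj₁ (f-factor r)

    f≡window : ∀ r → f r ≡ window (position r) n
    f≡window r = trans (sym (tabulate∘lookup (f r))) (tabulate-cong (proj₂ (f-factor r)))

    index : ℕ → Fin c
    index i = proj₁ (f-complete (window i n) (i , lookup∘tabulate _))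

    f-index : ∀ i → f (index i) ≡ window i n
    f-index i = proj₂ (f-complete (window i n) (i , lookup∘tabulate _))

    position-injective : ∀ r r′ → Agree x (position r) (position r′) n → r ≡ r′
    position-injective r r′ p =
      f-injective (trans (f≡window r) (trans (agree-window n p) (sym (f≡window r′))))

    position-index : ∀ i → Agree x (position (index i)) i n
    position-index i = window-agree n (trans (sym (f≡window (index i))) (f-index i))

    repeated : (P : Fin (suc c) → ℕ) → ∃[ r ] ∃[ r′ ] (r Fin.< r′ × Agree x (P r) (P r′) n)
    repeated P with r , r′ , r<r′ , eq ← pigeonhole (n<1+n c) (λ r → index (P r)) =
      r , r′ , r<r′ , window-agree n (trans (sym (f-index (P r))) (trans (cong f eq) (f-index (P r′))))

-- Sturmian words as words over two letters.

module Coding {k : ℕ} (x : Word k) (sturmian : Sturmian x) where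
  open Factors x

  private
    letters : Complexity x 1 2
    letters = sturmian 1 ≤-refl

  -- There are exactly two factors of length 1, so comparison with one of the two letters loses no
  -- information.
  z : ℕ → Bool
  z i = does (x i Fin.≟ x (position letters Fin.zero))

  z≡⇒x≡ : ∀ {i j} → z i ≡ z j → x i ≡ x j
  z≡⇒x≡ {i} {j} eq with x i Fin.≟ x (position letters Fin.zero) | x j Fin.≟ x (position letters Fin.zero)
  ... | yes p | yes q = trans p (sym q)
  ... | no  p | no  q = trans (other i p) (sym (other j q))
    where
    other : ∀ i → x i ≢ x (position letters Fin.zero) → x i ≡ x (position letters (Fin.suc Fin.zero))
    other i ≢ with index letters i | proj₁ (agree-uncons (position-index letters i))
    ... | Fin.zero         | eq = contradiction (sym eq) ≢
    ... | Fin.suc Fin.zero | eq = sym eq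

  x≡⇒z≡ : ∀ {i j} → x i ≡ x j → z i ≡ z j
  x≡⇒z≡ = cong λ l → does (l Fin.≟ x (position letters Fin.zero))

  decode : ∀ {i j n} → Agree z i j n → Agree x i j n
  decode p = agree λ l l<n → z≡⇒x≡ (at p l l<n)

  -- If all four extensions of w occurred, the factors c w of length n + 1 would both be
  -- right special, and there would be two more factors of length n + 2 than of length n + 1.
  uncrossed : Uncrossed z
  uncrossed n i before after same = collide (repeated longer extended)
    where
    shorter : Complexity x (suc n) (suc (suc n))
    shorter = sturmian (suc n) (s≤s z≤n)
    longer : Complexity x (suc (suc n)) (suc (suc (suc n)))
    longer = sturmian (suc (suc n)) (s≤s z≤n)

    prefixes : ∀ c d d′ → Agree x (i c d) (i c d′) (suc n)
    prefixes c d d′ = decode (agree-++ 1 (agree-1 (trans (before c d) (sym (before c d′))))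
      (subst₂ (λ u v → Agree z u v n) (+-comm 1 (i c d)) (+-comm 1 (i c d′))
        (agree-trans (same c d) (agree-sym (same c d′)))))

    chosen : Bool → Fin (suc (suc n))
    chosen c = index shorter (i c false)

    follower : Bool → Bool
    follower c = z (position shorter (chosen c) + suc n)

    -- The chosen representative of `c w` already supplies the extension by `follower c`; the other
    -- extension is new.
    extra : Bool → ℕ
    extra c = i c (not (follower c))

    -- These are `n + 4` positions with pairwise distinct factors of length `n + 2`, one more than
    -- the complexity allows.
    extended : Fin (suc (suc (suc (suc n)))) → ℕ
    extended Fin.zero              = extra false
    extended (Fin.suc Fin.zero)    = extra true
    extended (Fin.suc (Fin.suc r)) = position shorter r

    extra-new : ∀ c r → ¬ Agree x (extra c) (position shorter r) (suc (suc n))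
    extra-new c r p = Bool.not-¬ refl (begin
      follower c                        ≡⟨ cong (λ r → z (position shorter r + suc n)) chosen≡r ⟩
      z (position shorter r + suc n)    ≡⟨ x≡⇒z≡ (at p (suc n) ≤-refl) ⟨
      z (extra c + suc n)               ≡⟨ cong z (+-suc (extra c) n) ⟩
      z (suc (extra c) + n)             ≡⟨ after c (not (follower c)) ⟩
      not (follower c)                  ∎)
      where
      open ≡-Reasoning
      chosen≡r : chosen c ≡ r
      chosen≡r = position-injective shorter (chosen c) r
        (agree-trans (position-index shorter (i c false))
          (agree-trans (prefixes c false (not (follower c))) (agree-≤ (n≤1+n (suc n)) p)))

    collide : ¬ (∃[ r ] ∃[ r′ ] (r Fin.< r′ × Agree x (extended r) (extended r′) (suc (suc n))))
    collide (Fin.zero , Fin.suc Fin.zero , _ , p) = contradiction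
      (trans (sym (before false _)) (trans (x≡⇒z≡ (proj₁ (agree-uncons p))) (before true _))) λ ()
    collide (Fin.zero , Fin.suc (Fin.suc r) , _ , p) = extra-new false r p
    collide (Fin.suc Fin.zero , Fin.suc (Fin.suc r) , _ , p) = extra-new true r p
    collide (Fin.suc Fin.zero , Fin.suc Fin.zero , s≤s () , _)
    collide (Fin.suc (Fin.suc _) , Fin.suc Fin.zero , s≤s () , _)
    collide (Fin.suc (Fin.suc r) , Fin.suc (Fin.suc r′) , s≤s (s≤s r<r′) , p) =
      <-irrefl (cong toℕ (position-injective shorter r r′ (agree-≤ (n≤1+n (suc n)) p))) r<r′

-- From repetitions to the function r.

least : ∀ {P : ℕ → Set} → (∀ m → Dec (P m)) → ∀ m → P m → ∃[ l ] (l ≤ m × P l × (∀ l′ → P l′ → l ≤ l′))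
least {P} P? = <-rec _ λ m rec pm → search m rec pm (anyUpTo? P? m)
  where
  Least : ℕ → Set
  Least m = P m → ∃[ l ] (l ≤ m × P l × (∀ l′ → P l′ → l ≤ l′))
  search : ∀ m → (∀ {j} → j < m → Least j) → P m → Dec (∃[ j ] (j < m × P j)) →
           ∃[ l ] (l ≤ m × P l × (∀ l′ → P l′ → l ≤ l′))
  search m rec pm (yes (j , j<m , pj)) with l , l≤j , pl , min ← rec j<m pj =
    l , ≤-trans l≤j (<⇒≤ j<m) , pl , min
  search m rec pm (no none) =
    m , ≤-refl , pm , λ l pl → ≮⇒≥ λ l<m → none (l , l<m , pl)

-- The condition `i + n < m` bounds the start `i` by `m`, so the search is finite.
repEnd? : ∀ {k} (x : Word k) n m → Dec (RepEnd x n m)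
repEnd? x n m = map′
  (λ (i , _ , i+n<m , eq) → i , i+n<m , λ j j<n → eq j<n)
  (λ (i , i+n<m , eq) → i , ≤-<-trans (m≤m+n i n) i+n<m , i+n<m , λ {j} j<n → eq j j<n)
  (anyUpTo? (λ i → (i + n <? m) ×-dec allUpTo? (λ j → x (i + j) Fin.≟ x (m ∸ n + j)) n) m)

-- The later occurrence ends at `d + n`, an admissible value of `m`; decidability then provides the
-- least one.
repetition⇒IsR : ∀ {k} (x : Word k) {i d} n → i < d → Agree x i d n → ∃[ m ] (IsR x n m × m ≤ d + n)
repetition⇒IsR x {i} {d} n i<d same
  with m , m≤d+n , rep@(_ , j+n<m , _) , min ← least (repEnd? x n) (d + n)
         (i , +-monoˡ-< n i<d , λ j j<n → trans (at same j j<n) (cong (λ l → x (l + j)) (sym (m+n∸n≡m d n)))) =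
  m , (≤-<-trans z≤n j+n<m , rep , λ m′ _ → min m′) , m≤d+n

theorem3p4 : ∀ {k : ℕ} (s : Word k) → Sturmian s → RepAtMostBound s
theorem3p4 s sturmian p q 0<q above N = conclude good
  where
  open Coding s sturmian
  open Search z uncrossed N p q 0<q above
  conclude : Good → ∃[ n ] (N ≤ n × ∃[ m ] (IsR s n m × q * m < p * n))
  conclude (n , _ , _ , N≤n , i<d , same , small) =
    let m , isR , m≤ = repetition⇒IsR s n i<d (decode same)
    in n , N≤n , m , isR , ≤-<-trans (*-monoʳ-≤ q m≤) small
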